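{- For $n\ge1$ let \[ P_{n}(y,z,s,t)=P_{n}^{(\mathrm{lpk},\mathrm{ipk},\mathrm{des},\mathrm{ides})}(y,z,s,t)=\sum_{\pi\in\mathfrak{S}_{n}}y^{\mathrm{lpk}(\pi)}z^{\mathrm{ipk}(\pi)+1}s^{\mathrm{des}(\pi)}t^{\mathrm{ides}(\pi)+1}. \] Then, as formal power series, \begin{multline*} \frac{1}{(1-s)(1-t)}+\sum_{n=1}^{\infty}\frac{(1+ys)^{n}(1+zt)^{n+1}P_{n}\left(\frac{(1+y)^{2}s}{(y+s)(1+ys)},\frac{(1+z)^{2}t}{(z+t)(1+zt)},\frac{y+s}{1+ys},\frac{z+t}{1+zt}\right)}{(1+z)(1-s)^{n+1}(1-t)^{n+1}}x^{n}\\ =\sum_{i,j=0}^{\infty}\left(\frac{1+yx}{1-yzx}\right)^{ij}\left(\frac{1+zx}{1-x}\right)^{(i+1)j}s^{i}t^{j}. \end{multline*}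
   Context: $\mathfrak{S}_n$ is the symmetric group on $[n]$. For $\pi\in\mathfrak{S}_n$: $i\in[n-1]$ is a descent if $\pi(i)>\pi(i+1)$ and $\mathrm{des}(\pi)$ is the number of descents; $i$ with $2\le i\le n-1$ is a peak if $\pi(i-1)<\pi(i)>\pi(i+1)$ and $\mathrm{pk}(\pi)$ is the number of peaks; $i\in[n-1]$ is a left peak if $i$ is a peak, or if $i=1$ and $\pi(1)>\pi(2)$, and $\mathrm{lpk}(\pi)$ is the number of left peaks. Inverse statistics: $\mathrm{ides}(\pi)=\mathrm{des}(\pi^{ -1})$, $\mathrm{ipk}(\pi)=\mathrm{pk}(\pi^{ -1})$. -}

module Defs where

open import Data.Nat using (ℕ; zero; suc; _∸_; _<ᵇ_; _≡ᵇ_)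
open import Data.Bool using (Bool; true; false; if_then_else_; _∧_; not)
open import Data.List using (List; []; _∷_; length; map; concatMap; upTo; filterᵇ)
open import Algebra.Bundles using (CommutativeRing)
import Data.Nat as N

-- Permutations in one-line notation, as words π(1)…π(n) over {0,…,n-1}
-- (values shifted by 1; all statistics below only compare values).

words : ℕ → ℕ → List (List ℕ)
words n zero    = [] ∷ []
words n (suc k) = concatMap (λ a → map (a ∷_) (words n k)) (upTo n)

elemᵇ : ℕ → List ℕ → Bool
elemᵇ a []       = false
elemᵇ a (b ∷ bs) = if a ≡ᵇ b then true else elemᵇ a bs

distinctᵇ : List ℕ → Bool
distinctᵇ []       = true
distinctᵇ (a ∷ as) = not (elemᵇ a as) ∧ distinctᵇ as

Sym : ℕ → List (List ℕ)
Sym n = filterᵇ distinctᵇ (words n n)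

indexOf : ℕ → List ℕ → ℕ
indexOf a []       = 0
indexOf a (b ∷ bs) = if a ≡ᵇ b then 0 else suc (indexOf a bs)

inverse : List ℕ → List ℕ
inverse w = map (λ j → indexOf j w) (upTo (length w))

ind : Bool → ℕ
ind true  = 1
ind false = 0

des : List ℕ → ℕ
des (a ∷ b ∷ w) = ind (b <ᵇ a) N.+ des (b ∷ w)
des _           = 0

pk : List ℕ → ℕ
pk (a ∷ b ∷ c ∷ w) = ind ((a <ᵇ b) ∧ (c <ᵇ b)) N.+ pk (b ∷ c ∷ w)
pk _               = 0

lpk : List ℕ → ℕ
lpk (a ∷ b ∷ w) = ind (b <ᵇ a) N.+ pk (a ∷ b ∷ w)
lpk w           = pk w

ides : List ℕ → ℕ
ides w = des (inverse w)

ipk : List ℕ → ℕ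
ipk w = pk (inverse w)

-- Formal power series over an arbitrary commutative ring R
-- (quantifying over all R and y z ∈ R is equivalent to working with
-- polynomial coefficients in ℤ[y,z]).

module Series {c ℓ} (R : CommutativeRing c ℓ) where
  open CommutativeRing R hiding (zero)
  open N using () renaming (_+_ to _+ℕ_; _*_ to _*ℕ_)

  pow : Carrier → ℕ → Carrier
  pow a zero    = 1#
  pow a (suc k) = a * pow a k

  sumTo : ℕ → (ℕ → Carrier) → Carrier
  sumTo zero    f = f 0
  sumTo (suc m) f = sumTo m f + f (suc m)

  δ : ℕ → Carrier
  δ zero    = 1#
  δ (suc _) = 0#

  -- univariate power series (in x): coefficient of x^k
  PS1 : Set c
  PS1 = ℕ → Carrier

  _⊗₁_ : PS1 → PS1 → PS1
  (f ⊗₁ g) k = sumTo k (λ a → f a * g (k ∸ a))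

  pow₁ : PS1 → ℕ → PS1
  pow₁ f zero    = δ
  pow₁ f (suc k) = f ⊗₁ pow₁ f k

  onePlus₁ : Carrier → PS1
  onePlus₁ a zero          = 1#
  onePlus₁ a (suc zero)    = a
  onePlus₁ a (suc (suc _)) = 0#

  geom₁ : Carrier → PS1
  geom₁ a k = pow a k

  -- bivariate power series (in s, t): coefficient of s^i t^j
  PS2 : Set c
  PS2 = ℕ → ℕ → Carrier

  const : Carrier → PS2
  const a i j = δ i * (δ j * a)

  sVar : PS2
  sVar zero    j = 0#
  sVar (suc i) j = δ i * δ j

  tVar : PS2
  tVar i zero    = 0#
  tVar i (suc j) = δ i * δ j

  _⊕_ : PS2 → PS2 → PS2
  (f ⊕ g) i j = f i j + g i j

  _⊗_ : PS2 → PS2 → PS2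
  (f ⊗ g) i j = sumTo i (λ a → sumTo j (λ b → f a b * g (i ∸ a) (j ∸ b)))

  pow₂ : PS2 → ℕ → PS2
  pow₂ f zero    = const 1#
  pow₂ f (suc k) = f ⊗ pow₂ f k

  zero₂ : PS2
  zero₂ i j = 0#

  sumList : {A : Set} → List A → (A → PS2) → PS2
  sumList []       f = zero₂
  sumList (a ∷ as) f = f a ⊕ sumList as f

  geomS : PS2
  geomS i j = δ j

  geomT : PS2
  geomT i j = δ i

  invOnePlusS : Carrier → PS2
  invOnePlusS a i j = δ j * pow (- a) i

  invOnePlusT : Carrier → PS2
  invOnePlusT a i j = δ i * pow (- a) j

  module _ (y z : Carrier) where

    -- For π ∈ 𝔖_n with a = lpk, b = ipk, d = des, e = ides, the summand
    --   (1+ys)^n (1+zt)^(n+1) Y^a Z^(b+1) S^d T^(e+1) / (1+z)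
    -- with Y = (1+y)²s/((y+s)(1+ys)), S = (y+s)/(1+ys),
    --      Z = (1+z)²t/((z+t)(1+zt)), T = (z+t)/(1+zt)
    -- equals (cancelling (y+s)^a, (z+t)^(b+1), (1+z); note a ≤ d, b ≤ e)
    --   (1+ys)^n (1+zt)^(n+1) · (1+y)^(2a) s^a (y+s)^(d-a) (1+ys)^-(a+d)
    --   · (1+z)^(2b+1) t^(b+1) (z+t)^(e-b) (1+zt)^-(b+e+2).
    term : ℕ → List ℕ → PS2
    term n π =
      let a = lpk π ; b = ipk π ; d = des π ; e = ides π in
      pow₂ (const 1# ⊕ (const y ⊗ sVar)) n ⊗ (pow₂ (const 1# ⊕ (const z ⊗ tVar)) (suc n) ⊗
      (pow₂ (const (1# + y)) (2 *ℕ a) ⊗ (pow₂ sVar a ⊗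
      (pow₂ (const y ⊕ sVar) (d ∸ a) ⊗ (pow₂ (invOnePlusS y) (a +ℕ d) ⊗
      (pow₂ (const (1# + z)) (2 *ℕ b +ℕ 1) ⊗ (pow₂ tVar (b +ℕ 1) ⊗
      (pow₂ (const z ⊕ tVar) (e ∸ b) ⊗ pow₂ (invOnePlusT z) (b +ℕ e +ℕ 2)))))))))

    numer : ℕ → PS2
    numer n = sumList (Sym n) (term n)

    LHS : ℕ → ℕ → ℕ → Carrier
    LHS zero    = geomS ⊗ geomT
    LHS (suc m) = numer (suc m) ⊗ (pow₂ geomS (suc (suc m)) ⊗ pow₂ geomT (suc (suc m)))

    RHS : ℕ → ℕ → ℕ → Carrier
    RHS n i j =
      (pow₁ (onePlus₁ y ⊗₁ geom₁ (y * z)) (i *ℕ j) ⊗₁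
       pow₁ (onePlus₁ z ⊗₁ geom₁ 1#) (suc i *ℕ j)) n

{-# OPTIONS --safe #-}
-- Both sides count, for fixed i and j, weighted multisets of n cells in the product of two
-- alphabets of plain and barred letters: A = {0 < 1′ < 1 < … < i′ < i} and B = {1′ < 1 < … < j′ < j},
-- where barred letters weigh y in A and z in B, and a cell may be repeated iff its two letters are
-- both plain or both barred.  Cell by cell this gives the product on the right.
--
-- Writing a multiset as a biword sorted by its A-letters and standardizing the word w of its
-- B-letters (ties between plain letters from left to right, between barred ones from right to left)
-- yields a permutation π, a sequence over A compatible with the descents of π and a sequence over B
-- compatible with the descents of π⁻¹.  For one permutation, the generating function in s (or t)
-- of the compatible sequences is computed by a transfer argument: with O and V the series for
-- alphabets of odd and even size, an ascent multiplies the pair by 1/(1-s) and replaces O by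
-- (1+ys)O, V by s(1+y)O; a descent replaces O by (1+y)V, V by (y+s)V.  Counting the resulting
-- factors gives exactly the powers recorded by (lpk, des) for A and (pk, des) for B.
module Submission where

open import Defs
open import Data.Bool using (Bool; true; false; T; not; _∧_; if_then_else_)
open import Data.Bool.Properties using (not-involutive; T?; T-≡; T-∧)
open import Data.Empty using (⊥-elim)
open import Data.List using (List; []; _∷_; _++_; length; map; concatMap; upTo; applyUpTo; filterᵇ; cartesianProductWith; cartesianProduct)
open import Data.List.Properties using (length-map; length-upTo; length-++; map-upTo; upTo-∷ʳ; map-∘; map-cong-local; map-id-local; ∷-injective)
open import Data.List.Membership.Propositional using (_∈_)
open import Data.List.Membership.Propositional.Properties using (∈-cartesianProductWith⁺; ∈-cartesianProductWith⁻; ∈-cartesianProduct⁺; ∈-cartesianProduct⁻; ∈-upTo⁺; ∈-upTo⁻; ∈-filter⁺; ∈-filter⁻; ∈-map⁺; ∈-map⁻; ∈-∃++)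
open import Data.List.Membership.Propositional.Properties.WithK using (unique∧set⇒bag)
open import Data.List.Relation.Binary.BagAndSetEquality using (∼bag⇒↭)
open import Data.List.Relation.Binary.Permutation.Propositional using (_↭_; ↭-refl; ↭-sym; ↭-trans; ↭-prep; ↭-reflexive; prep; swap)
import Data.List.Relation.Binary.Permutation.Propositional.Properties as ↭
open import Data.List.Relation.Unary.All using (All; []; _∷_)
import Data.List.Relation.Unary.All as All
import Data.List.Relation.Unary.All.Properties as All
open import Data.List.Relation.Unary.AllPairs using ([]; _∷_)
open import Data.List.Relation.Unary.Any using (here; there)
open import Data.List.Relation.Unary.Unique.Propositional using (Unique)
import Data.List.Relation.Unary.Unique.Propositional.Properties as Unique
open import Data.Nat using (ℕ; zero; suc; _∸_; _≤_; _<_; _<ᵇ_; _≡ᵇ_; z≤n; s≤s)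
import Data.Nat as ℕ
import Data.Nat.Properties as ℕ
open import Data.Product using (∃; _×_; _,_; proj₁; proj₂)
open import Data.Sum using (inj₁; inj₂)
open import Data.Unit using (tt)
open import Function using (_∘_)
open import Function.Bundles using (Equivalence; mk⇔)
open import Algebra.Bundles using (CommutativeRing)
import Algebra.Properties.CommutativeSemigroup as CommutativeSemigroupProperties
import Algebra.Properties.Group as GroupProperties
import Algebra.Solver.Ring.NaturalCoefficients.Default as Solver
open import Relation.Nullary using (yes; no)
open import Relation.Binary.Definitions using (tri<; tri≈; tri>)
open import Relation.Binary.PropositionalEquality as ≡ using (_≡_; _≢_)
import Relation.Binary.Reasoning.Setoid as SetoidReasoning

-- Boolean comparison of natural numbers.

<ᵇ-true : ∀ {a b} → a < b → (a <ᵇ b) ≡ true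
<ᵇ-true {a} {b} a<b with a <ᵇ b | ℕ.<⇒<ᵇ a<b
... | true | _ = ≡.refl

<ᵇ-false : ∀ {a b} → b ≤ a → (a <ᵇ b) ≡ false
<ᵇ-false {a} {b} b≤a with a <ᵇ b in eq
... | false = ≡.refl
... | true  = ⊥-elim (ℕ.<-irrefl ≡.refl (ℕ.<-≤-trans (ℕ.<ᵇ⇒< a b (≡.subst T (≡.sym eq) tt)) b≤a))

≡ᵇ-refl : ∀ a → (a ≡ᵇ a) ≡ true
≡ᵇ-refl zero    = ≡.refl
≡ᵇ-refl (suc a) = ≡ᵇ-refl a

≡ᵇ-false : ∀ {a b} → a ≢ b → (a ≡ᵇ b) ≡ false
≡ᵇ-false {a} {b} a≢b with a ≡ᵇ b in eq
... | false = ≡.refl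
... | true  = ⊥-elim (a≢b (ℕ.≡ᵇ⇒≡ a b (≡.subst T (≡.sym eq) _)))

<ᵇ-suc : ∀ {b k} → b ≢ k → (b <ᵇ suc k) ≡ (b <ᵇ k)
<ᵇ-suc {b} {k} b≢k with ℕ.<-cmp b k
... | tri< b<k _ _ = ≡.trans (<ᵇ-true (ℕ.m≤n⇒m≤1+n b<k)) (≡.sym (<ᵇ-true b<k))
... | tri≈ _ b≡k _ = ⊥-elim (b≢k b≡k)
... | tri> _ _ k<b = ≡.trans (<ᵇ-false k<b) (≡.sym (<ᵇ-false (ℕ.<⇒≤ k<b)))

-- Formal power series

module PowerSeries {c ℓ} (R : CommutativeRing c ℓ) where
  open CommutativeRing R hiding (zero)
  open Series R
  open SetoidReasoning setoid
  open CommutativeSemigroupProperties +-commutativeSemigroup using (interchange)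

  infix 4 _≋_
  _≋_ : PS1 → PS1 → Set ℓ
  f ≋ g = ∀ k → f k ≈ g k

  tail : PS1 → PS1
  tail f k = f (suc k)

  scale : Carrier → PS1 → PS1
  scale a f k = a * f k

  add : PS1 → PS1 → PS1
  add f g k = f k + g k

  sumTo-cong : ∀ n {f g : PS1} → (∀ a → a ≤ n → f a ≈ g a) → sumTo n f ≈ sumTo n g
  sumTo-cong zero    h = h 0 z≤n
  sumTo-cong (suc n) h = +-cong (sumTo-cong n (λ a a≤n → h a (ℕ.m≤n⇒m≤1+n a≤n))) (h (suc n) ℕ.≤-refl)

  sumTo-unfoldˡ : ∀ n f → sumTo (suc n) f ≈ f 0 + sumTo n (tail f)
  sumTo-unfoldˡ zero    f = refl
  sumTo-unfoldˡ (suc n) f = trans (+-congʳ (sumTo-unfoldˡ n f)) (+-assoc _ _ _)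

  sumTo-0 : ∀ n {f : PS1} → f ≋ (λ _ → 0#) → sumTo n f ≈ 0#
  sumTo-0 zero    h = h 0
  sumTo-0 (suc n) h = trans (+-cong (sumTo-0 n h) (h (suc n))) (+-identityˡ 0#)

  sumTo-+ : ∀ n f g → sumTo n (add f g) ≈ sumTo n f + sumTo n g
  sumTo-+ zero    f g = refl
  sumTo-+ (suc n) f g = trans (+-congʳ (sumTo-+ n f g)) (interchange _ _ _ _)

  sumTo-*ˡ : ∀ n a f → sumTo n (scale a f) ≈ a * sumTo n f
  sumTo-*ˡ zero    a f = refl
  sumTo-*ˡ (suc n) a f = trans (+-congʳ (sumTo-*ˡ n a f)) (sym (distribˡ _ _ _))

  ⊗₁-cong : ∀ {f f′ g g′} → f ≋ f′ → g ≋ g′ → f ⊗₁ g ≋ f′ ⊗₁ g′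
  ⊗₁-cong p q k = sumTo-cong k (λ a _ → *-cong (p a) (q (k ∸ a)))

  ⊗₁-unfoldˡ : ∀ f g k → (f ⊗₁ g) (suc k) ≈ f 0 * g (suc k) + (tail f ⊗₁ g) k
  ⊗₁-unfoldˡ f g k = sumTo-unfoldˡ k _

  ⊗₁-unfoldʳ : ∀ f g k → (f ⊗₁ g) (suc k) ≈ (f ⊗₁ tail g) k + f (suc k) * g 0
  ⊗₁-unfoldʳ f g k = +-cong
    (sumTo-cong k (λ a a≤k → *-congˡ (reflexive (≡.cong g (ℕ.+-∸-assoc 1 a≤k)))))
    (*-congˡ (reflexive (≡.cong g (ℕ.n∸n≡0 k))))

  -- Peeling off the first term of one product and the last term of the other leaves products with
  -- `tail f` at a smaller index.
  ⊗₁-comm : ∀ f g → f ⊗₁ g ≋ g ⊗₁ f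
  ⊗₁-comm f g zero    = *-comm _ _
  ⊗₁-comm f g (suc k) = begin
    (f ⊗₁ g) (suc k)                    ≈⟨ ⊗₁-unfoldˡ f g k ⟩
    f 0 * g (suc k) + (tail f ⊗₁ g) k   ≈⟨ +-cong (*-comm _ _) (⊗₁-comm (tail f) g k) ⟩
    g (suc k) * f 0 + (g ⊗₁ tail f) k   ≈⟨ +-comm _ _ ⟩
    (g ⊗₁ tail f) k + g (suc k) * f 0   ≈⟨ ⊗₁-unfoldʳ g f k ⟨
    (g ⊗₁ f) (suc k)                    ∎

  ⊗₁-distribʳ : ∀ h f g → add f g ⊗₁ h ≋ add (f ⊗₁ h) (g ⊗₁ h)
  ⊗₁-distribʳ h f g k = trans (sumTo-cong k (λ a _ → distribʳ _ _ _)) (sumTo-+ k _ _)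

  ⊗₁-scale : ∀ a f g → scale a f ⊗₁ g ≋ scale a (f ⊗₁ g)
  ⊗₁-scale a f g k = trans (sumTo-cong k (λ b _ → *-assoc _ _ _)) (sumTo-*ˡ k _ _)

  ⊗₁-assoc : ∀ f g h → (f ⊗₁ g) ⊗₁ h ≋ f ⊗₁ (g ⊗₁ h)
  ⊗₁-assoc f g h zero    = *-assoc _ _ _
  ⊗₁-assoc f g h (suc k) = begin
    ((f ⊗₁ g) ⊗₁ h) (suc k)
      ≈⟨ ⊗₁-unfoldˡ (f ⊗₁ g) h k ⟩
    f 0 * g 0 * h (suc k) + (tail (f ⊗₁ g) ⊗₁ h) k
      ≈⟨ +-congˡ (⊗₁-cong {g = h} (⊗₁-unfoldˡ f g) (λ _ → refl) k) ⟩
    f 0 * g 0 * h (suc k) + (add (scale (f 0) (tail g)) (tail f ⊗₁ g) ⊗₁ h) k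
      ≈⟨ +-cong (*-assoc _ _ _) (⊗₁-distribʳ h _ _ k) ⟩
    f 0 * (g 0 * h (suc k)) + ((scale (f 0) (tail g) ⊗₁ h) k + ((tail f ⊗₁ g) ⊗₁ h) k)
      ≈⟨ +-congˡ (+-cong (⊗₁-scale (f 0) (tail g) h k) (⊗₁-assoc (tail f) g h k)) ⟩
    f 0 * (g 0 * h (suc k)) + (f 0 * (tail g ⊗₁ h) k + (tail f ⊗₁ (g ⊗₁ h)) k)
      ≈⟨ +-assoc _ _ _ ⟨
    (f 0 * (g 0 * h (suc k)) + f 0 * (tail g ⊗₁ h) k) + (tail f ⊗₁ (g ⊗₁ h)) k
      ≈⟨ +-congʳ (distribˡ _ _ _) ⟨
    f 0 * (g 0 * h (suc k) + (tail g ⊗₁ h) k) + (tail f ⊗₁ (g ⊗₁ h)) k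
      ≈⟨ +-congʳ (*-congˡ (⊗₁-unfoldˡ g h k)) ⟨
    f 0 * (g ⊗₁ h) (suc k) + (tail f ⊗₁ (g ⊗₁ h)) k
      ≈⟨ ⊗₁-unfoldˡ f (g ⊗₁ h) k ⟨
    (f ⊗₁ (g ⊗₁ h)) (suc k) ∎

  constant : Carrier → PS1
  constant a zero    = a
  constant a (suc _) = 0#

  shift : PS1 → PS1
  shift f zero    = 0#
  shift f (suc k) = f k

  X : PS1
  X = shift δ

  constant-⊗₁ : ∀ a f → constant a ⊗₁ f ≋ scale a f
  constant-⊗₁ a f zero    = refl
  constant-⊗₁ a f (suc k) = begin
    (constant a ⊗₁ f) (suc k)                       ≈⟨ ⊗₁-unfoldˡ (constant a) f k ⟩
    a * f (suc k) + (tail (constant a) ⊗₁ f) k      ≈⟨ +-congˡ (sumTo-0 k (λ b → zeroˡ _)) ⟩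
    a * f (suc k) + 0#                              ≈⟨ +-identityʳ _ ⟩
    a * f (suc k)                                   ∎

  constant-1# : constant 1# ≋ δ
  constant-1# zero    = refl
  constant-1# (suc k) = refl

  ⊗₁-identityˡ : ∀ f → δ ⊗₁ f ≋ f
  ⊗₁-identityˡ f k = begin
    (δ ⊗₁ f) k             ≈⟨ ⊗₁-cong {g = f} constant-1# (λ _ → refl) k ⟨
    (constant 1# ⊗₁ f) k   ≈⟨ constant-⊗₁ 1# f k ⟩
    1# * f k               ≈⟨ *-identityˡ _ ⟩
    f k                    ∎

  X-⊗₁ : ∀ f → X ⊗₁ f ≋ shift f
  X-⊗₁ f zero    = zeroˡ _
  X-⊗₁ f (suc k) = begin
    (X ⊗₁ f) (suc k)              ≈⟨ ⊗₁-unfoldˡ X f k ⟩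
    0# * f (suc k) + (δ ⊗₁ f) k   ≈⟨ +-cong (zeroˡ _) (⊗₁-identityˡ f k) ⟩
    0# + f k                      ≈⟨ +-identityˡ _ ⟩
    f k                           ∎

  -- Since the construction works over any commutative ring, applying it twice yields the bivariate
  -- series together with a ring solver.
  psRing : CommutativeRing c ℓ
  psRing = record
    { Carrier = PS1
    ; _≈_ = _≋_
    ; _+_ = add
    ; _*_ = _⊗₁_
    ; -_ = λ f k → - f k
    ; 0# = λ _ → 0#
    ; 1# = δ
    ; isCommutativeRing = record
      { isRing = record
        { +-isAbelianGroup = record
          { isGroup = record
            { isMonoid = record
              { isSemigroup = record
                { isMagma = record
                  { isEquivalence = record
                    { refl = λ _ → refl
                    ; sym = λ p k → sym (p k)
                    ; trans = λ p q k → trans (p k) (q k)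
                    }
                  ; ∙-cong = λ p q k → +-cong (p k) (q k)
                  }
                ; assoc = λ f g h k → +-assoc _ _ _
                }
              ; identity = (λ f k → +-identityˡ _) , (λ f k → +-identityʳ _)
              }
            ; inverse = (λ f k → -‿inverseˡ _) , (λ f k → -‿inverseʳ _)
            ; ⁻¹-cong = λ p k → -‿cong (p k)
            }
          ; comm = λ f g k → +-comm _ _
          }
        ; *-cong = λ {f} {f′} {g} {g′} → ⊗₁-cong {f} {f′} {g} {g′}
        ; *-assoc = ⊗₁-assoc
        ; *-identity = ⊗₁-identityˡ , λ f k → trans (⊗₁-comm f δ k) (⊗₁-identityˡ f k)
        ; distrib = (λ h f g k → trans (⊗₁-comm h (add f g) k)
                        (trans (⊗₁-distribʳ h f g k)
                          (+-cong (⊗₁-comm f h k) (⊗₁-comm g h k))))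
                  , ⊗₁-distribʳ
        }
      ; *-comm = ⊗₁-comm
      }
    }

-- Descent patterns and alphabets of plain and barred letters

-- The last entry is a sentinel: the word is followed by a virtual ascent.
stepPattern : (ℕ → ℕ → Bool) → List ℕ → List Bool
stepPattern D []          = []
stepPattern D (a ∷ [])    = false ∷ []
stepPattern D (a ∷ b ∷ w) = D a b ∷ stepPattern D (b ∷ w)

descends : ℕ → ℕ → Bool
descends a b = b <ᵇ a

pat : List ℕ → List Bool
pat = stepPattern descends

data Step (a b : ℕ) (w : List ℕ) : Set where
  ascent  : (b <ᵇ a) ≡ false → lpk (a ∷ b ∷ w) ≡ lpk (b ∷ w) → pk (a ∷ b ∷ w) ≡ lpk (b ∷ w) →
            des (a ∷ b ∷ w) ≡ des (b ∷ w) → Step a b w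
  descent : (b <ᵇ a) ≡ true → lpk (a ∷ b ∷ w) ≡ suc (pk (b ∷ w)) → pk (a ∷ b ∷ w) ≡ pk (b ∷ w) →
            des (a ∷ b ∷ w) ≡ suc (des (b ∷ w)) → Step a b w

-- A smaller letter in front turns an initial descent of the tail into a peak, so both peak counts
-- become its `lpk`. A larger letter in front keeps b from being a peak and is itself a left peak.
step : ∀ {a b} → a ≢ b → ∀ w → Step a b w
step {a} {b} a≢b w with ℕ.<-cmp a b
... | tri≈ _ a≡b _ = ⊥-elim (a≢b a≡b)
... | tri< a<b _ _ = ascent b<a≡f (≡.trans (≡.cong (λ x → ind x ℕ.+ pk (a ∷ b ∷ w)) b<a≡f) (pk-asc w)) (pk-asc w)
                       (≡.cong (λ x → ind x ℕ.+ des (b ∷ w)) b<a≡f)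
  where
  b<a≡f = <ᵇ-false (ℕ.<⇒≤ a<b)
  pk-asc : ∀ w → pk (a ∷ b ∷ w) ≡ lpk (b ∷ w)
  pk-asc []      = ≡.refl
  pk-asc (c ∷ w) = ≡.cong (λ x → ind (x ∧ (c <ᵇ b)) ℕ.+ pk (b ∷ c ∷ w)) (<ᵇ-true a<b)
... | tri> _ _ b<a = descent b<a≡t
                       (≡.trans (≡.cong (λ x → ind x ℕ.+ pk (a ∷ b ∷ w)) b<a≡t) (≡.cong suc (pk-desc w))) (pk-desc w)
                       (≡.cong (λ x → ind x ℕ.+ des (b ∷ w)) b<a≡t)
  where
  b<a≡t = <ᵇ-true b<a
  pk-desc : ∀ w → pk (a ∷ b ∷ w) ≡ pk (b ∷ w)
  pk-desc []      = ≡.refl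
  pk-desc (c ∷ w) = ≡.cong (λ x → ind (x ∧ (c <ᵇ b)) ℕ.+ pk (b ∷ c ∷ w)) (<ᵇ-false (ℕ.<⇒≤ b<a))

-- The two bounds need a joint induction: an ascent replaces `pk` by `lpk` of the tail, and a
-- descent makes `lpk` one more than `pk` of the tail.
peaks≤des : ∀ w → Unique w → lpk w ≤ des w × pk w ≤ des w
peaks≤des []          _ = z≤n , z≤n
peaks≤des (a ∷ [])    _ = z≤n , z≤n
peaks≤des (a ∷ b ∷ w) ((a≢b ∷ _) ∷ uniq) with step a≢b w | peaks≤des (b ∷ w) uniq
... | ascent  _ l p d | l≤d , p≤d rewrite l | p | d = l≤d , l≤d
... | descent _ l p d | l≤d , p≤d rewrite l | p | d = s≤s p≤d , ℕ.m≤n⇒m≤1+n p≤d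

length-pattern : ∀ D w → length (stepPattern D w) ≡ length w
length-pattern D []          = ≡.refl
length-pattern D (a ∷ [])    = ≡.refl
length-pattern D (a ∷ b ∷ w) = ≡.cong suc (length-pattern D (b ∷ w))

odd : ℕ → Bool
odd zero    = false
odd (suc m) = not (odd m)

twice : ℕ → ℕ
twice zero    = 0
twice (suc i) = suc (suc (twice i))

odd-twice : ∀ i → odd (twice i) ≡ false
odd-twice zero    = ≡.refl
odd-twice (suc i) = ≡.trans (not-involutive _) (odd-twice i)

-- Letter m may be repeated across a step of type d (true = descent) iff odd m = d.
bound : Bool → ℕ → ℕ
bound d m = if d then (if odd m then suc m else m) else (if odd m then m else suc m)

-- Larger codes are smaller letters; a repeated barred letter counts as a descent.
superDescends : ℕ → ℕ → Bool
superDescends a b = if a ≡ᵇ b then odd a else a <ᵇ b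

spat : List ℕ → List Bool
spat = stepPattern superDescends

-- The letters that may follow a without a descent form an initial segment of the codes, containing
-- a itself iff a is plain. This lets the rows of cells be built up from the sets `below k` and
-- `above k`.
not-superDescends : ∀ a b → not (superDescends a b) ≡ (b <ᵇ bound false a)
not-superDescends a b with ℕ.<-cmp a b
... | tri< a<b a≢b _ rewrite ≡ᵇ-false a≢b | <ᵇ-true a<b with odd a
...   | true  = ≡.sym (<ᵇ-false (ℕ.<⇒≤ a<b))
...   | false = ≡.sym (<ᵇ-false a<b)
not-superDescends a b | tri> _ a≢b b<a rewrite ≡ᵇ-false a≢b | <ᵇ-false (ℕ.<⇒≤ b<a) with odd a
...   | true  = ≡.sym (<ᵇ-true b<a)
...   | false = ≡.sym (<ᵇ-true (ℕ.m≤n⇒m≤1+n b<a))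
not-superDescends a b | tri≈ _ ≡.refl _ rewrite ≡ᵇ-refl a with odd a
...   | true  = ≡.sym (<ᵇ-false {a} ℕ.≤-refl)
...   | false = ≡.sym (<ᵇ-true {a} ℕ.≤-refl)

-- O and V stand for the generating functions of odd and even alphabet sizes;
-- G and v for 1/(1-s) and 1/(1+ys).
module ClosedForm {c ℓ} (K : CommutativeRing c ℓ) where
  open CommutativeRing K hiding (zero)
  open Series K using (pow)
  open SetoidReasoning setoid
  open Solver commutativeSemiring using (solve; _:=_; _:+_; _:*_; con)
  open GroupProperties +-group using (∙-cancelˡ)

  -- With Y = (1+y)²s/((y+s)(1+ys)), S = (y+s)/(1+ys) and v = 1/(1+ys), this is (1+ys)^n Y^a S^d
  -- after cancelling powers of y+s.
  leftPeakForm : (y s v : Carrier) (n a d : ℕ) → Carrier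
  leftPeakForm y s v n a d =
    pow (1# + y * s) n * (pow (1# + y) (2 ℕ.* a) * (pow s a * (pow (y + s) (d ∸ a) * pow v (a ℕ.+ d))))

  -- In the same notation, (1+ys)^(n+1) Y^(b+1) S^(e+1) / (1+y).
  peakForm : (y s v : Carrier) (n b e : ℕ) → Carrier
  peakForm y s v n b e =
    pow (1# + y * s) (suc n) * (pow (1# + y) (suc (2 ℕ.* b)) * (pow s (suc b) *
      (pow (y + s) (e ∸ b) * pow v (suc (suc (b ℕ.+ e))))))

  module _ (y s G v : Carrier)
           (G-inverse : G ≈ 1# + s * G) (v-inverse : (1# + y * s) * v ≈ 1#)
           (O V : List Bool → Carrier)
           (O-[]   : O [] ≈ G)
           (O-asc  : ∀ ds → O (false ∷ ds) ≈ V (false ∷ ds) + O ds)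
           (V-asc  : ∀ ds → V (false ∷ ds) ≈ s * (O (false ∷ ds) + y * O ds))
           (O-desc : ∀ d ds → O (true ∷ d ∷ ds) ≈ V (true ∷ d ∷ ds) + V (d ∷ ds))
           (V-desc : ∀ d ds → V (true ∷ d ∷ ds) ≈ s * O (true ∷ d ∷ ds) + y * V (d ∷ ds))
           where

    u : Carrier
    u = 1# + y * s

    -- Division by 1-s without subtraction: `G-inverse` determines G, and the summand sGA is added
    -- on both sides and cancelled at the end, so that the semiring solver suffices.
    solve-geometric : ∀ {A B} → A ≈ s * A + B → A ≈ G * B
    solve-geometric {A} {B} eq = sym (∙-cancelˡ (s * G * A) (G * B) A (begin
      s * G * A + G * B   ≈⟨ solve 4 (λ s G A B → s :* G :* A :+ G :* B := G :* (s :* A :+ B)) refl s G A B ⟩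
      G * (s * A + B)     ≈⟨ *-congˡ eq ⟨
      G * A               ≈⟨ *-congʳ G-inverse ⟩
      (1# + s * G) * A    ≈⟨ solve 3 (λ s G A → (con 1 :+ s :* G) :* A := s :* G :* A :+ A) refl s G A ⟩
      s * G * A + A       ∎))

    O-ascent : ∀ ds → O (false ∷ ds) ≈ G * (u * O ds)
    O-ascent ds = solve-geometric (begin
      O (false ∷ ds)
        ≈⟨ O-asc ds ⟩
      V (false ∷ ds) + O ds
        ≈⟨ +-congʳ (V-asc ds) ⟩
      s * (O (false ∷ ds) + y * O ds) + O ds
        ≈⟨ solve 4 (λ s y a b → s :* (a :+ y :* b) :+ b := s :* a :+ (con 1 :+ y :* s) :* b) refl s y _ _ ⟩
      s * O (false ∷ ds) + u * O ds ∎)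

    V-ascent : ∀ ds → V (false ∷ ds) ≈ G * (s * (1# + y) * O ds)
    V-ascent ds = solve-geometric (begin
      V (false ∷ ds)
        ≈⟨ V-asc ds ⟩
      s * (O (false ∷ ds) + y * O ds)
        ≈⟨ *-congˡ (+-congʳ (O-asc ds)) ⟩
      s * (V (false ∷ ds) + O ds + y * O ds)
        ≈⟨ solve 4 (λ s y a b → s :* (a :+ b :+ y :* b) := s :* a :+ s :* (con 1 :+ y) :* b) refl s y _ _ ⟩
      s * V (false ∷ ds) + s * (1# + y) * O ds ∎)

    O-descent : ∀ d ds → O (true ∷ d ∷ ds) ≈ G * ((1# + y) * V (d ∷ ds))
    O-descent d ds = solve-geometric (begin
      O (true ∷ d ∷ ds)
        ≈⟨ O-desc d ds ⟩
      V (true ∷ d ∷ ds) + V (d ∷ ds)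
        ≈⟨ +-congʳ (V-desc d ds) ⟩
      s * O (true ∷ d ∷ ds) + y * V (d ∷ ds) + V (d ∷ ds)
        ≈⟨ solve 3 (λ y a b → a :+ y :* b :+ b := a :+ (con 1 :+ y) :* b) refl y _ _ ⟩
      s * O (true ∷ d ∷ ds) + (1# + y) * V (d ∷ ds) ∎)

    V-descent : ∀ d ds → V (true ∷ d ∷ ds) ≈ G * ((y + s) * V (d ∷ ds))
    V-descent d ds = solve-geometric (begin
      V (true ∷ d ∷ ds)
        ≈⟨ V-desc d ds ⟩
      s * O (true ∷ d ∷ ds) + y * V (d ∷ ds)
        ≈⟨ +-congʳ (*-congˡ (O-desc d ds)) ⟩
      s * (V (true ∷ d ∷ ds) + V (d ∷ ds)) + y * V (d ∷ ds)
        ≈⟨ solve 4 (λ s y a b → s :* (a :+ b) :+ y :* b := s :* a :+ (y :+ s) :* b) refl s y _ _ ⟩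
      s * V (true ∷ d ∷ ds) + (y + s) * V (d ∷ ds) ∎)

    private
      formO formV : (n a d : ℕ) → Carrier
      formO = leftPeakForm y s v
      formV = peakForm y s v

    drop-uv : ∀ x → u * v * x ≈ x
    drop-uv x = trans (*-congʳ v-inverse) (*-identityˡ x)

    -- The right side has two more factors u and two more factors v than the left; they are inserted
    -- as uv = 1.
    formV-ascent : ∀ n l d → s * (1# + y) * formO n l d ≈ formV (suc n) l d
    formV-ascent n l d = begin
      s * (1# + y) * formO n l d
        ≈⟨ drop-uv _ ⟨
      u * v * (s * (1# + y) * formO n l d)
        ≈⟨ drop-uv _ ⟨
      u * v * (u * v * (s * (1# + y) * formO n l d))
        ≈⟨ solve 9 (λ u v s w un wl sl ys vd →
             u :* v :* (u :* v :* (s :* w :* (un :* (wl :* (sl :* (ys :* vd))))))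
             := u :* (u :* un) :* (w :* wl :* (s :* sl :* (ys :* (v :* (v :* vd))))))
             refl u v s (1# + y) (pow u n) (pow (1# + y) (2 ℕ.* l)) (pow s l) (pow (y + s) (d ∸ l)) (pow v (l ℕ.+ d)) ⟩
      formV (suc n) l d ∎

    formO-descent : ∀ n p d → (1# + y) * formV n p d ≈ formO (suc n) (suc p) (suc d)
    formO-descent n p d = begin
      (1# + y) * formV n p d
        ≈⟨ solve 5 (λ w un wl sl r → w :* (un :* (wl :* (sl :* r))) := un :* (w :* wl :* (sl :* r)))
             refl (1# + y) (pow u (suc n)) (pow (1# + y) (suc (2 ℕ.* p))) (pow s (suc p)) _ ⟩
      pow u (suc n) * (pow (1# + y) (suc (suc (2 ℕ.* p))) * (pow s (suc p) *
        (pow (y + s) (d ∸ p) * pow v (suc (suc (p ℕ.+ d))))))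
        ≡⟨ ≡.cong₂ (λ i j → pow u (suc n) * (pow (1# + y) (suc i) * (pow s (suc p) *
             (pow (y + s) (d ∸ p) * pow v (suc j)))))
             (≡.sym (ℕ.+-suc p (p ℕ.+ 0))) (≡.sym (ℕ.+-suc p d)) ⟩
      formO (suc n) (suc p) (suc d) ∎

    formV-descent : ∀ n p d → p ≤ d → (y + s) * formV n p d ≈ formV (suc n) p (suc d)
    formV-descent n p d p≤d = begin
      (y + s) * formV n p d
        ≈⟨ drop-uv _ ⟨
      u * v * ((y + s) * formV n p d)
        ≈⟨ solve 8 (λ u v t un wl sl ys vd →
             u :* v :* (t :* (un :* (wl :* (sl :* (ys :* vd)))))
             := u :* un :* (wl :* (sl :* (t :* ys :* (v :* vd)))))
             refl u v (y + s) (pow u (suc n)) (pow (1# + y) (suc (2 ℕ.* p))) (pow s (suc p))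
             (pow (y + s) (d ∸ p)) (pow v (suc (suc (p ℕ.+ d)))) ⟩
      pow u (suc (suc n)) * (pow (1# + y) (suc (2 ℕ.* p)) * (pow s (suc p) *
        (pow (y + s) (suc (d ∸ p)) * pow v (suc (suc (suc (p ℕ.+ d)))))))
        -- Truncated subtraction: (d + 1) ∸ p is one more than d ∸ p because p ≤ d.
        ≡⟨ ≡.cong₂ (λ i j → pow u (suc (suc n)) * (pow (1# + y) (suc (2 ℕ.* p)) * (pow s (suc p) *
             (pow (y + s) i * pow v (suc (suc j))))))
             (≡.sym (ℕ.+-∸-assoc 1 p≤d)) (≡.sym (ℕ.+-suc p d)) ⟩
      formV (suc n) p (suc d) ∎

    private
      absorb : ∀ {x F F′} n → x * F ≈ F′ → G * (x * (pow G n * F)) ≈ pow G (suc n) * F′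
      absorb {x} {F} {F′} n eq = begin
        G * (x * (pow G n * F))  ≈⟨ solve 4 (λ G x g F → G :* (x :* (g :* F)) := G :* g :* (x :* F)) refl G x _ F ⟩
        pow G (suc n) * (x * F)  ≈⟨ *-congˡ eq ⟩
        pow G (suc n) * F′       ∎

    -- Each letter applies one transfer formula and contributes one factor G. The two forms are
    -- proved together, since an ascent expresses V through O and a descent expresses O through V.
    closed-forms : ∀ a w → Unique (a ∷ w) → let n = suc (length w) in
      O (pat (a ∷ w)) ≈ pow G (suc n) * formO n (lpk (a ∷ w)) (des (a ∷ w)) ×
      V (pat (a ∷ w)) ≈ pow G (suc n) * formV n (pk (a ∷ w)) (des (a ∷ w))
    -- A single letter still carries the sentinel ascent: one factor G comes from it and one from
    -- `O-[]`, whence the exponent n + 1.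
    closed-forms a [] _ =
      (begin
        O (false ∷ [])   ≈⟨ O-ascent [] ⟩
        G * (u * O [])   ≈⟨ *-congˡ (*-congˡ O-[]) ⟩
        G * (u * G)      ≈⟨ solve 2 (λ G u → G :* (u :* G) :=
                              G :* (G :* con 1) :* (u :* con 1 :* (con 1 :* (con 1 :* (con 1 :* con 1))))) refl G u ⟩
        pow G 2 * formO 1 0 0 ∎) ,
      (begin
        V (false ∷ [])              ≈⟨ V-ascent [] ⟩
        G * (s * (1# + y) * O [])   ≈⟨ *-congˡ (*-congˡ O-[]) ⟩
        G * (s * (1# + y) * G)      ≈⟨ solve 3 (λ G s w → G :* (s :* w :* G) := G :* (w :* (s :* G)))
                                        refl G s (1# + y) ⟩
        G * ((1# + y) * (s * G))    ≈⟨ drop-uv _ ⟨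
        u * v * (G * ((1# + y) * (s * G))) ≈⟨ drop-uv _ ⟨
        u * v * (u * v * (G * ((1# + y) * (s * G))))
                                    ≈⟨ solve 5 (λ G s w u v → u :* v :* (u :* v :* (G :* (w :* (s :* G)))) :=
                                        G :* (G :* con 1) :* (u :* (u :* con 1) :* (w :* con 1 :* (s :* con 1 :* (con 1 :* (v :* (v :* con 1)))))))
                                        refl G s (1# + y) u v ⟩
        pow G 2 * formV 1 0 0 ∎)
    closed-forms a (b ∷ w) ((a≢b ∷ _) ∷ uniq) with step a≢b w | closed-forms b w uniq | peaks≤des (b ∷ w) uniq
    ... | ascent d l p e | ihO , ihV | _ rewrite d | l | p | e =
      trans (O-ascent _) (trans (*-congˡ (*-congˡ ihO)) (absorb (suc (suc (length w))) (sym (*-assoc _ _ _)))) ,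
      trans (V-ascent _) (trans (*-congˡ (*-congˡ ihO)) (absorb (suc (suc (length w))) (formV-ascent (suc (length w)) (lpk (b ∷ w)) (des (b ∷ w)))))
    -- The descent formulas apply only if the remaining pattern is nonempty; the sentinel guarantees
    -- this, and the split exposes its head.
    ... | descent d l p e | ihO , ihV | _ , p≤e with pat (b ∷ w) in eq
    ...   | [] = ⊥-elim (nonempty w eq)
      where
      nonempty : ∀ {b} w → pat (b ∷ w) ≢ []
      nonempty []      ()
      nonempty (c ∷ w) ()
    ...   | d′ ∷ ds rewrite d | p | e =
      trans (O-descent _ _) (trans (*-congˡ (*-congˡ ihV)) (absorb (suc (suc (length w))) (formO-descent (suc (length w)) (pk (b ∷ w)) (des (b ∷ w))))) ,
      trans (V-descent _ _) (trans (*-congˡ (*-congˡ ihV)) (absorb (suc (suc (length w))) (formV-descent (suc (length w)) (pk (b ∷ w)) (des (b ∷ w)) p≤e)))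

-- Weighted counts of compatible sequences.

module Counting {c ℓ} (R : CommutativeRing c ℓ) where
  open CommutativeRing R hiding (zero)
  open Series R
  open PowerSeries R

  weight : Carrier → ℕ → Carrier
  weight y m = if odd m then y else 1#

  -- The weight of all sequences of letters below m compatible with the pattern.
  -- The letters 0, 1, 2, … are i, i′, i-1, (i-1)′, … (plain ones even, barred ones odd),
  -- so that the alphabet grows at its end.
  N : Carrier → List Bool → ℕ → Carrier
  N y []       m       = 1#
  N y (d ∷ ds) zero    = 0#
  N y (d ∷ ds) (suc m) = N y (d ∷ ds) m + weight y m * N y ds (bound d m)

  -- The sizes 2i + 1 and 2i are those of the alphabets A and B with largest plain letter i; the
  -- resulting series in i play the roles of O and V.
  odds evens : Carrier → List Bool → PS1
  odds  y ds i = N y ds (suc (twice i))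
  evens y ds i = N y ds (twice i)

  -- The new letter 2i is plain, hence of weight 1 and repeatable across an ascent: after it, all 2i
  -- + 1 letters remain available.
  N-plain-asc : ∀ y ds i → odds y (false ∷ ds) i ≈ evens y (false ∷ ds) i + odds y ds i
  N-plain-asc y ds i rewrite odd-twice i = +-congˡ (*-identityˡ _)

  N-plain-desc : ∀ y ds i → odds y (true ∷ ds) i ≈ evens y (true ∷ ds) i + evens y ds i
  N-plain-desc y ds i rewrite odd-twice i = +-congˡ (*-identityˡ _)

  -- The last letter 2i + 1 of an alphabet of size 2i + 2 is barred, so an ascent after it leaves
  -- the 2i + 1 letters below it. The step from i to i + 1 is the shift.
  N-bar-asc : ∀ y ds → evens y (false ∷ ds) ≋ shift (add (odds y (false ∷ ds)) (scale y (odds y ds)))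
  N-bar-asc y ds zero    = refl
  N-bar-asc y ds (suc i) rewrite odd-twice i = refl

  -- A barred letter may be repeated across a descent, so its summand keeps the full size and is not
  -- shifted. At size 0 that summand must vanish; it does because d ∷ ds is nonempty, whereas the
  -- empty pattern has weight 1 there.
  N-bar-desc : ∀ y d ds → evens y (true ∷ d ∷ ds) ≋ add (shift (odds y (true ∷ d ∷ ds))) (scale y (evens y (d ∷ ds)))
  N-bar-desc y d ds zero    = sym (trans (+-identityˡ _) (zeroʳ y))
  N-bar-desc y d ds (suc i) = reflexive (≡.cong
    (λ b → N y (true ∷ d ∷ ds) (suc (twice i)) +
           (if not b then y else 1#) * N y (d ∷ ds) (if not b then suc (suc (twice i)) else suc (twice i)))
    (odd-twice i))

-- Bivariate series as series in s over series in t.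

module Bivariate {c ℓ} (R : CommutativeRing c ℓ) where
  open CommutativeRing R hiding (zero)
  open Series R
  open PowerSeries R public
  open Counting R public
  module P = CommutativeRing psRing
  module P-Series = Series psRing
  module P-PowerSeries = PowerSeries psRing
  module Q = CommutativeRing P-PowerSeries.psRing
  open Series P-PowerSeries.psRing using () renaming (pow to powQ)
  open Q using () renaming (_≈_ to _≈₂_; _*_ to _*₂_)

  sumTo-pointwise : ∀ i (F : ℕ → PS1) j → P-Series.sumTo i F j ≡ sumTo i (λ a → F a j)
  sumTo-pointwise zero    F j = ≡.refl
  sumTo-pointwise (suc i) F j = ≡.cong (_+ F (suc i) j) (sumTo-pointwise i F j)

  -- The two products differ only in whether the outer sum is taken of series or of their
  -- coefficients. This carries the laws of the iterated series ring over to `PS2`.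
  ⊗≈* : ∀ f g → f ⊗ g ≈₂ f *₂ g
  ⊗≈* f g i j = reflexive (≡.sym (sumTo-pointwise i (λ a → f a ⊗₁ g (i ∸ a)) j))

  ⊗-cong : ∀ {f f′ g g′} → f ≈₂ f′ → g ≈₂ g′ → f ⊗ g ≈₂ f′ *₂ g′
  ⊗-cong {f} {f′} {g} {g′} p q = Q.trans {f ⊗ g} {f *₂ g} {f′ *₂ g′} (⊗≈* f g) (Q.*-cong {f} {f′} {g} {g′} p q)

  const-1 : const 1# ≈₂ Q.1#
  const-1 zero    zero    = trans (*-identityˡ _) (*-identityˡ _)
  const-1 zero    (suc j) = trans (*-identityˡ _) (zeroˡ _)
  const-1 (suc i) j       = zeroˡ _

  pow₂-cong : ∀ {f g k l} → f ≈₂ g → k ≡ l → pow₂ f k ≈₂ powQ g l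
  pow₂-cong {f} {g} {zero}  p ≡.refl = const-1
  pow₂-cong {f} {g} {suc k} p ≡.refl = ⊗-cong {f} {g} {pow₂ f k} {powQ g k} p (pow₂-cong {f} {g} {k} p ≡.refl)

  const≈ : ∀ a → const a ≈₂ P-PowerSeries.constant (constant a)
  const≈ a zero    zero    = trans (*-identityˡ _) (*-identityˡ _)
  const≈ a zero    (suc j) = trans (*-identityˡ _) (zeroˡ _)
  const≈ a (suc i) j       = zeroˡ _

  const-* : ∀ a f i j → (const a *₂ f) i j ≈ a * f i j
  const-* a f i j = trans (Q.*-congʳ {f} {const a} {P-PowerSeries.constant (constant a)} (const≈ a) i j)
    (trans (P-PowerSeries.constant-⊗₁ (constant a) f i j) (constant-⊗₁ a (f i) j))

  sVar-* : ∀ f i → (sVar *₂ f) i P.≈ P-PowerSeries.shift f i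
  sVar-* f i j = trans (Q.*-congʳ {f} {sVar} {P-PowerSeries.X} sVar≈ i j) (P-PowerSeries.X-⊗₁ f i j)
    where
    sVar≈ : sVar ≈₂ P-PowerSeries.X
    sVar≈ zero          j       = refl
    sVar≈ (suc zero)    j       = *-identityˡ _
    sVar≈ (suc (suc i)) j       = zeroˡ _

  tVar-* : ∀ f i j → (tVar *₂ f) i j ≈ shift (f i) j
  tVar-* f i j = trans (Q.*-congʳ {f} {tVar} {P-PowerSeries.constant X} tVar≈ i j)
    (trans (P-PowerSeries.constant-⊗₁ X f i j) (X-⊗₁ (f i) j))
    where
    tVar≈ : tVar ≈₂ P-PowerSeries.constant X
    tVar≈ zero    zero    = refl
    tVar≈ zero    (suc j) = *-identityˡ _
    tVar≈ (suc i) zero    = refl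
    tVar≈ (suc i) (suc j) = zeroˡ _

  inS inT : PS1 → PS2
  inS f i j = δ j * f i
  inT f i j = δ i * f j

  inS-* : ∀ f g i j → (inS f *₂ inT g) i j ≈ f i * g j
  inS-* f g i j = begin
    (inS f *₂ inT g) i j                         ≈⟨ Q.*-congˡ {inS f} {inT g} inT≈ i j ⟩
    (inS f *₂ P-PowerSeries.constant g) i j      ≈⟨ Q.*-comm (inS f) (P-PowerSeries.constant g) i j ⟩
    (P-PowerSeries.constant g *₂ inS f) i j      ≈⟨ P-PowerSeries.constant-⊗₁ g (inS f) i j ⟩
    (g ⊗₁ inS f i) j                             ≈⟨ ⊗₁-comm g (inS f i) j ⟩
    (inS f i ⊗₁ g) j                             ≈⟨ ⊗₁-cong {g = g} inS≈ (λ _ → refl) j ⟩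
    (constant (f i) ⊗₁ g) j                      ≈⟨ constant-⊗₁ (f i) g j ⟩
    f i * g j                                    ∎
    where
    open SetoidReasoning setoid
    inT≈ : inT g ≈₂ P-PowerSeries.constant g
    inT≈ zero    j = *-identityˡ _
    inT≈ (suc i) j = zeroˡ _
    inS≈ : inS f i ≋ constant (f i)
    inS≈ zero    = *-identityˡ _
    inS≈ (suc j) = zeroˡ _

  -- Collects what `inS` with `sVar` and `inT` with `tVar` have in common, so that the transfer
  -- argument serves both alphabets.
  module Embedding
    (φ : PS1 → PS2) (var : PS2)
    (φ-cong : ∀ {f g} → f ≋ g → φ f ≈₂ φ g)
    (φ-1 : φ δ ≈₂ Q.1#)
    (φ-+ : ∀ f g → φ (add f g) ≈₂ φ f ⊕ φ g)
    (φ-shift : ∀ f → φ (shift f) ≈₂ var *₂ φ f)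
    (φ-scale : ∀ a f → φ (scale a f) ≈₂ const a *₂ φ f)
    (y : Carrier) where

    open SetoidReasoning Q.setoid
    open Solver Q.commutativeSemiring using (solve; _:=_; _:+_; _:*_; con)

    ones : PS1
    ones _ = 1#

    private
      Y = const y
      G = φ ones
      v = φ (geom₁ (- y))

      G-inverse : G ≈₂ Q.1# ⊕ (var *₂ G)
      G-inverse = begin
        φ ones                    ≈⟨ φ-cong (λ { zero → sym (+-identityʳ _) ; (suc k) → sym (+-identityˡ _) }) ⟩
        φ (add δ (shift ones))    ≈⟨ φ-+ δ (shift ones) ⟩
        φ δ ⊕ φ (shift ones)      ≈⟨ Q.+-cong {φ δ} {Q.1#} {φ (shift ones)} {var *₂ G} φ-1 (φ-shift ones) ⟩
        Q.1# ⊕ (var *₂ G)         ∎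

      v-inverse : (Q.1# ⊕ (Y *₂ var)) *₂ v ≈₂ Q.1#
      v-inverse = begin
        (Q.1# ⊕ (Y *₂ var)) *₂ v
          ≈⟨ solve 3 (λ Y s v → (con 1 :+ Y :* s) :* v := v :+ Y :* (s :* v)) (λ _ _ → refl) Y var v ⟩
        v ⊕ (Y *₂ (var *₂ v))
          ≈⟨ Q.+-congˡ {v} (Q.*-congˡ {Y} (φ-shift (geom₁ (- y)))) ⟨
        v ⊕ (Y *₂ φ (shift (geom₁ (- y))))
          ≈⟨ Q.+-congˡ {v} (φ-scale y (shift (geom₁ (- y)))) ⟨
        v ⊕ φ (scale y (shift (geom₁ (- y))))
          ≈⟨ φ-+ (geom₁ (- y)) (scale y (shift (geom₁ (- y)))) ⟨
        φ (add (geom₁ (- y)) (scale y (shift (geom₁ (- y)))))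
          ≈⟨ φ-cong telescope ⟩
        φ δ
          ≈⟨ φ-1 ⟩
        Q.1# ∎
        where
        telescope : add (geom₁ (- y)) (scale y (shift (geom₁ (- y)))) ≋ δ
        telescope zero    = trans (+-congˡ (zeroʳ y)) (+-identityʳ _)
        telescope (suc k) = trans (sym (distribʳ _ _ _)) (trans (*-congʳ (-‿inverseˡ y)) (zeroˡ _))

      O V : List Bool → PS2
      O ds = φ (odds y ds)
      V ds = φ (evens y ds)

      V-asc : ∀ ds → V (false ∷ ds) ≈₂ var *₂ (O (false ∷ ds) ⊕ (Y *₂ O ds))
      V-asc ds = begin
        V (false ∷ ds)
          ≈⟨ φ-cong (N-bar-asc y ds) ⟩
        φ (shift (add (odds y (false ∷ ds)) (scale y (odds y ds))))
          ≈⟨ φ-shift _ ⟩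
        var *₂ φ (add (odds y (false ∷ ds)) (scale y (odds y ds)))
          ≈⟨ Q.*-congˡ {var} (φ-+ _ _) ⟩
        var *₂ (O (false ∷ ds) ⊕ φ (scale y (odds y ds)))
          ≈⟨ Q.*-congˡ {var} (Q.+-congˡ {O (false ∷ ds)} (φ-scale y _)) ⟩
        var *₂ (O (false ∷ ds) ⊕ (Y *₂ O ds)) ∎

      V-desc : ∀ d ds → V (true ∷ d ∷ ds) ≈₂ (var *₂ O (true ∷ d ∷ ds)) ⊕ (Y *₂ V (d ∷ ds))
      V-desc d ds = begin
        V (true ∷ d ∷ ds)
          ≈⟨ φ-cong (N-bar-desc y d ds) ⟩
        φ (add (shift (odds y (true ∷ d ∷ ds))) (scale y (evens y (d ∷ ds))))
          ≈⟨ φ-+ _ _ ⟩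
        φ (shift (odds y (true ∷ d ∷ ds))) ⊕ φ (scale y (evens y (d ∷ ds)))
          ≈⟨ Q.+-cong (φ-shift _) (φ-scale y _) ⟩
        (var *₂ O (true ∷ d ∷ ds)) ⊕ (Y *₂ V (d ∷ ds)) ∎

    open ClosedForm P-PowerSeries.psRing

    closed = closed-forms Y var G v G-inverse v-inverse O V
      -- The empty pattern has weight 1 for every alphabet, so its series is G by definition.
      (Q.refl {G})
      (λ ds → Q.trans (φ-cong (N-plain-asc y ds)) (φ-+ _ _))
      V-asc
      (λ d ds → Q.trans (φ-cong (N-plain-desc y (d ∷ ds))) (φ-+ _ _))
      V-desc

  open CommutativeSemigroupProperties *-commutativeSemigroup using (x∙yz≈y∙xz)

  inS-δ : inS δ ≈₂ Q.1#
  inS-δ zero    zero    = *-identityˡ _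
  inS-δ zero    (suc j) = zeroˡ _
  inS-δ (suc i) j       = zeroʳ _

  inT-δ : inT δ ≈₂ Q.1#
  inT-δ zero    j = *-identityˡ _
  inT-δ (suc i) j = zeroˡ _

  shift-inS : ∀ f i j → inS (shift f) i j ≈ P-PowerSeries.shift (inS f) i j
  shift-inS f zero    j = zeroʳ _
  shift-inS f (suc i) j = refl

  shift-inT : ∀ f i j → inT (shift f) i j ≈ shift (inT f i) j
  shift-inT f i zero    = zeroʳ _
  shift-inT f i (suc j) = refl

  module S = Embedding inS sVar
    (λ p i j → *-congˡ (p i))
    inS-δ
    (λ f g i j → distribˡ _ _ _)
    (λ f i j → trans (shift-inS f i j) (sym (sVar-* (inS f) i j)))
    (λ a f i j → trans (x∙yz≈y∙xz _ _ _) (sym (const-* a (inS f) i j)))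

  module T = Embedding inT tVar
    (λ p i j → *-congˡ (p j))
    inT-δ
    (λ f g i j → distribˡ _ _ _)
    (λ f i j → trans (shift-inT f i j) (sym (tVar-* (inT f) i j)))
    (λ a f i j → trans (x∙yz≈y∙xz _ _ _) (sym (const-* a (inT f) i j)))

  open ClosedForm P-PowerSeries.psRing using (leftPeakForm; peakForm)

  module _ (y z : Carrier) where
    private
      G H v w : PS2
      G = inS (λ _ → 1#)
      H = inT (λ _ → 1#)
      v = invOnePlusS y
      w = invOnePlusT z

    one-plus : ∀ a var → const 1# ⊕ (const a ⊗ var) ≈₂ Q.1# ⊕ (const a *₂ var)
    one-plus a var = Q.+-cong {const 1#} {Q.1#} const-1 (⊗≈* (const a) var)

    const-1+ : ∀ a → const (1# + a) ≈₂ Q.1# ⊕ const a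
    const-1+ a i j = trans (*-congˡ (distribˡ _ _ _)) (trans (distribˡ _ _ _) (+-congʳ (const-1 i j)))

    -- The factors are sorted into those in s and those in t; each group takes its own power of the
    -- geometric series and becomes one side of a closed form.
    term-factors : ∀ n π → let a = lpk π ; b = ipk π ; d = des π ; e = ides π in
      term y z n π ⊗ (pow₂ geomS (suc n) ⊗ pow₂ geomT (suc n)) ≈₂
      (powQ G (suc n) *₂ leftPeakForm (const y) sVar v n a d) *₂
      (powQ H (suc n) *₂ peakForm (const z) tVar w n b e)
    term-factors n π = Q.trans
      (⊗-cong {term y z n π}
        (⊗-cong (pow₂-cong {k = n} (one-plus y sVar) ≡.refl)
        (⊗-cong (pow₂-cong {k = suc n} (one-plus z tVar) ≡.refl)
        (⊗-cong (pow₂-cong {k = 2 ℕ.* a} (const-1+ y) ≡.refl)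
        (⊗-cong (pow₂-cong {k = a} (Q.refl {sVar}) ≡.refl)
        (⊗-cong (pow₂-cong {k = d ∸ a} (Q.refl {const y ⊕ sVar}) ≡.refl)
        (⊗-cong (pow₂-cong {k = a ℕ.+ d} (Q.refl {v}) ≡.refl)
        (⊗-cong (pow₂-cong (const-1+ z) (ℕ.+-comm (2 ℕ.* b) 1))
        (⊗-cong (pow₂-cong (Q.refl {tVar}) (ℕ.+-comm b 1))
        (⊗-cong (pow₂-cong {k = e ∸ b} (Q.refl {const z ⊕ tVar}) ≡.refl)
                (pow₂-cong (Q.refl {w}) (ℕ.+-comm (b ℕ.+ e) 2)))))))))))
        (⊗-cong (pow₂-cong {geomS} {G} {suc n} (λ i j → sym (*-identityʳ _)) ≡.refl)
                (pow₂-cong {geomT} {H} {suc n} (λ i j → sym (*-identityʳ _)) ≡.refl)))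
      (solve 12 (λ un um wa sa ys va wb tb zt vb g h →
        un :* (um :* (wa :* (sa :* (ys :* (va :* (wb :* (tb :* (zt :* vb)))))))) :* (g :* h) :=
        g :* (un :* (wa :* (sa :* (ys :* va)))) :* (h :* (um :* (wb :* (tb :* (zt :* vb))))))
        (λ _ _ → refl)
        (powQ (Q.1# ⊕ (const y *₂ sVar)) n) (powQ (Q.1# ⊕ (const z *₂ tVar)) (suc n))
        (powQ (Q.1# ⊕ const y) (2 ℕ.* a)) (powQ sVar a) (powQ (const y ⊕ sVar) (d ∸ a)) (powQ v (a ℕ.+ d))
        (powQ (Q.1# ⊕ const z) (suc (2 ℕ.* b))) (powQ tVar (suc b)) (powQ (const z ⊕ tVar) (e ∸ b))
        (powQ w (suc (suc (b ℕ.+ e)))) (powQ G (suc n)) (powQ H (suc n)))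
      where
      open Solver Q.commutativeSemiring using (solve; _:=_; _:*_)
      a = lpk π
      b = ipk π
      d = des π
      e = ides π

    -- Read backwards, the closed forms make the summand a series in s times a series in t. Their
    -- coefficients weigh the sequences over A compatible with π and those over B compatible with
    -- its inverse.
    term-product : ∀ a π → Unique (a ∷ π) → Unique (inverse (a ∷ π)) → let n = suc (length π) in ∀ i j →
      (term y z n (a ∷ π) ⊗ (pow₂ geomS (suc n) ⊗ pow₂ geomT (suc n))) i j ≈
      odds y (pat (a ∷ π)) i * evens z (pat (inverse (a ∷ π))) j
    term-product a π uniq uniq⁻¹ i j = begin
      (term y z n (a ∷ π) ⊗ (pow₂ geomS (suc n) ⊗ pow₂ geomT (suc n))) i j
        ≈⟨ term-factors n (a ∷ π) i j ⟩
      ((powQ G (suc n) *₂ leftPeakForm (const y) sVar v n (lpk (a ∷ π)) (des (a ∷ π))) *₂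
       (powQ H (suc n) *₂ peakForm (const z) tVar w n (ipk (a ∷ π)) (ides (a ∷ π)))) i j
        ≈⟨ Q.*-cong (Q.sym (proj₁ (S.closed y a π uniq))) (Q.sym T-closed) i j ⟩
      (inS (odds y (pat (a ∷ π))) *₂ inT (evens z (pat (inverse (a ∷ π))))) i j
        ≈⟨ inS-* (odds y (pat (a ∷ π))) (evens z (pat (inverse (a ∷ π)))) i j ⟩
      odds y (pat (a ∷ π)) i * evens z (pat (inverse (a ∷ π))) j ∎
      where
      open SetoidReasoning setoid
      n = suc (length π)
      T-closed : inT (evens z (pat (inverse (a ∷ π)))) ≈₂
                 powQ H (suc n) *₂ peakForm (const z) tVar w n (ipk (a ∷ π)) (ides (a ∷ π))
      -- The closed form is stated with the length of the inverse, which is rewritten to the length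
      -- of the permutation.
      T-closed = ≡.subst (λ m → inT (evens z (pat (inverse (a ∷ π)))) ≈₂
                   powQ H (suc m) *₂ peakForm (const z) tVar w m (ipk (a ∷ π)) (ides (a ∷ π)))
                   (≡.trans (length-map _ (upTo n)) (length-upTo n))
                   (proj₂ (T.closed z _ _ uniq⁻¹))

-- Standardization

module Permutations where
  open import Data.Nat using (_+_; _*_)
  open ≡ using (refl; sym; trans; cong; cong₂; subst; subst₂; module ≡-Reasoning)
  open CommutativeSemigroupProperties ℕ.+-commutativeSemigroup using (x∙yz≈y∙xz)

  -- Enumeration of words and permutations.

  words-× : ∀ M n → words M (suc n) ≡ cartesianProductWith _∷_ (upTo M) (words M n)
  words-× M n = go (upTo M)
    where
    go : ∀ as → concatMap (λ a → map (a ∷_) (words M n)) as ≡ cartesianProductWith _∷_ as (words M n)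
    go []       = refl
    go (a ∷ as) = cong (map (a ∷_) (words M n) ++_) (go as)

  words-unique : ∀ M n → Unique (words M n)
  words-unique M zero    = [] ∷ []
  words-unique M (suc n) = subst Unique (sym (words-× M n))
    (Unique.cartesianProductWith⁺ _∷_ ∷-injective (Unique.upTo⁺ M) (words-unique M n))

  ∈-words⁺ : ∀ {M} w → All (_< M) w → w ∈ words M (length w)
  ∈-words⁺     []      []           = here refl
  ∈-words⁺ {M} (a ∷ w) (a<M ∷ w<M) = subst ((a ∷ w) ∈_) (sym (words-× M (length w)))
    (∈-cartesianProductWith⁺ _∷_ (∈-upTo⁺ a<M) (∈-words⁺ w w<M))

  ∈-words⁻ : ∀ {M} n {w} → w ∈ words M n → length w ≡ n × All (_< M) w
  ∈-words⁻     zero    (here refl) = refl , []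
  ∈-words⁻ {M} (suc n) w∈
    with a , v , a∈ , v∈ , refl ← ∈-cartesianProductWith⁻ _∷_ (upTo M) (words M n) (subst (_ ∈_) (words-× M n) w∈)
    with len , v<M ← ∈-words⁻ n v∈
    = cong suc len , ∈-upTo⁻ a∈ ∷ v<M

  elemᵇ-false : ∀ {a w} → All (a ≢_) w → elemᵇ a w ≡ false
  elemᵇ-false []          = refl
  elemᵇ-false (a≢b ∷ a≢w) rewrite ≡ᵇ-false a≢b = elemᵇ-false a≢w

  elemᵇ-false⁻ : ∀ {a} w → T (not (elemᵇ a w)) → All (a ≢_) w
  elemᵇ-false⁻     []      _ = []
  elemᵇ-false⁻ {a} (b ∷ w) t with a ≡ᵇ b in eq
  ... | true  = ⊥-elim t
  ... | false = a≢b ∷ elemᵇ-false⁻ w t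
    where
    a≢b : a ≢ b
    a≢b refl with () ← trans (sym eq) (≡ᵇ-refl a)

  distinct⇒unique : ∀ w → T (distinctᵇ w) → Unique w
  distinct⇒unique []      _ = []
  distinct⇒unique (a ∷ w) t with t₁ , t₂ ← Equivalence.to T-∧ t = elemᵇ-false⁻ w t₁ ∷ distinct⇒unique w t₂

  unique⇒distinct : ∀ {w} → Unique w → T (distinctᵇ w)
  unique⇒distinct []             = tt
  unique⇒distinct (a≢w ∷ uniq) rewrite elemᵇ-false a≢w = unique⇒distinct uniq

  ∈-Sym⁺ : ∀ π → All (_< length π) π → Unique π → π ∈ Sym (length π)
  ∈-Sym⁺ π π<n uniq = ∈-filter⁺ (T? ∘ distinctᵇ) (∈-words⁺ π π<n) (unique⇒distinct uniq)

  ∈-Sym⁻ : ∀ {n π} → π ∈ Sym n → length π ≡ n × All (_< n) π × Unique π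
  ∈-Sym⁻ {n} {π} π∈ with π∈words , t ← ∈-filter⁻ (T? ∘ distinctᵇ) π∈ with len , π<n ← ∈-words⁻ n π∈words =
    len , π<n , distinct⇒unique π t

  Sym-unique : ∀ n → Unique (Sym n)
  Sym-unique n = Unique.filter⁺ (T? ∘ distinctᵇ) (words-unique n n)

  ∈-tail : ∀ {A : Set} {x z : A} {xs ys} → All (x ≢_) xs → z ∈ xs → z ∈ x ∷ ys → z ∈ ys
  ∈-tail x≢xs z∈ (here refl) = ⊥-elim (All.lookup x≢xs z∈ refl)
  ∈-tail x≢xs z∈ (there z∈′) = z∈′

  unique-⊆⇒↭ : ∀ {A : Set} {xs : List A} ys → Unique xs → (∀ {x} → x ∈ xs → x ∈ ys) → ∃ λ zs → ys ↭ xs ++ zs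
  unique-⊆⇒↭ {xs = []}     ys _              _     = ys , ↭-refl
  unique-⊆⇒↭ {xs = x ∷ xs} ys (x≢xs ∷ uniq) xs⊆ys
    with ys₁ , ys₂ , refl ← ∈-∃++ (xs⊆ys (here refl))
    with zs , p ← unique-⊆⇒↭ (ys₁ ++ ys₂) uniq (λ z∈ → ∈-tail x≢xs z∈ (↭.∈-resp-↭ (↭.shift x ys₁ ys₂) (xs⊆ys (there z∈))))
    = zs , ↭-trans (↭.shift x ys₁ ys₂) (↭-prep x p)

  -- Pigeonhole: n distinct letters below n exhaust `upTo n`, since any leftover would make that
  -- list longer than n.
  Sym-↭ : ∀ {n π} → π ∈ Sym n → π ↭ upTo n
  Sym-↭ {n} {π} π∈ with len , π<n , uniq ← ∈-Sym⁻ {n} π∈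
    with unique-⊆⇒↭ (upTo n) uniq (λ x∈ → ∈-upTo⁺ (All.lookup π<n x∈))
  ... | []     , p = ↭-sym (↭-trans p (↭.++-identityʳ π))
  ... | z ∷ zs , p = ⊥-elim (ℕ.<-irrefl (trans (sym (length-upTo n)) (trans (↭.↭-length p) (trans (length-++ π) (cong (_+ suc (length zs)) len)))) (ℕ.m<m+n n (s≤s z≤n)))

  -- Letters by position and the inverse permutation.

  nth : List ℕ → ℕ → ℕ
  nth []      _       = 0
  nth (a ∷ w) zero    = a
  nth (a ∷ w) (suc k) = nth w k

  nth-∈ : ∀ w {k} → k < length w → nth w k ∈ w
  nth-∈ (a ∷ w) {zero}  _         = here refl
  nth-∈ (a ∷ w) {suc k} (s≤s k<n) = there (nth-∈ w k<n)

  nth-applyUpTo : ∀ (f : ℕ → ℕ) {n k} → k < n → nth (applyUpTo f n) k ≡ f k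
  nth-applyUpTo f {suc n} {zero}  _         = refl
  nth-applyUpTo f {suc n} {suc k} (s≤s k<n) = nth-applyUpTo (f ∘ suc) k<n

  nth-map-upTo : ∀ (f : ℕ → ℕ) {n k} → k < n → nth (map f (upTo n)) k ≡ f k
  nth-map-upTo f {n} k<n = trans (cong (λ w → nth w _) (map-upTo f n)) (nth-applyUpTo f k<n)

  nth-map : ∀ (f : ℕ → ℕ) w {k} → k < length w → nth (map f w) k ≡ f (nth w k)
  nth-map f (a ∷ w) {zero}  _         = refl
  nth-map f (a ∷ w) {suc k} (s≤s k<n) = nth-map f w k<n

  map-nth : ∀ w → map (nth w) (upTo (length w)) ≡ w
  map-nth w = trans (map-upTo (nth w) (length w)) (go w)
    where
    go : ∀ w → applyUpTo (nth w) (length w) ≡ w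
    go []      = refl
    go (a ∷ w) = cong (a ∷_) (go w)

  map-upTo-cong : ∀ {A : Set} {f g : ℕ → A} n → (∀ k → k < n → f k ≡ g k) → map f (upTo n) ≡ map g (upTo n)
  map-upTo-cong n h = map-cong-local (All.tabulate (λ k∈ → h _ (∈-upTo⁻ k∈)))

  indexOf-here : ∀ a w → indexOf a (a ∷ w) ≡ 0
  indexOf-here a w rewrite ≡ᵇ-refl a = refl

  indexOf-there : ∀ {a b} w → a ≢ b → indexOf a (b ∷ w) ≡ suc (indexOf a w)
  indexOf-there w a≢b rewrite ≡ᵇ-false a≢b = refl

  indexOf-< : ∀ {a w} → a ∈ w → indexOf a w < length w × nth w (indexOf a w) ≡ a
  indexOf-< {a} {b ∷ w} a∈ with a ℕ.≟ b
  ... | yes refl rewrite indexOf-here a w = s≤s z≤n , refl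
  ... | no a≢b   rewrite indexOf-there w a≢b with a∈
  ...   | here a≡b = ⊥-elim (a≢b a≡b)
  ...   | there a∈w with lt , eq ← indexOf-< a∈w = s≤s lt , eq

  indexOf-nth : ∀ {w k} → Unique w → k < length w → indexOf (nth w k) w ≡ k
  indexOf-nth {a ∷ w} {zero}  _             _         = indexOf-here a w
  indexOf-nth {a ∷ w} {suc k} (a≢w ∷ uniq) (s≤s k<n) =
    trans (indexOf-there w (λ eq → All.lookup a≢w (nth-∈ w k<n) (sym eq))) (cong suc (indexOf-nth uniq k<n))

  module Permutation {n π} (π∈ : π ∈ Sym n) where
    private
      len  = proj₁ (∈-Sym⁻ {n} π∈)
      π<n  = proj₁ (proj₂ (∈-Sym⁻ {n} π∈))

    π-unique : Unique π
    π-unique = proj₂ (proj₂ (∈-Sym⁻ {n} π∈))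

    π-< : ∀ {p} → p < n → nth π p < n
    π-< p<n = All.lookup π<n (nth-∈ π (subst (_ <_) (sym len) p<n))

    π⁻¹ : ℕ → ℕ
    π⁻¹ k = indexOf k π

    private
      ∈π : ∀ {k} → k < n → k ∈ π
      ∈π k<n = ↭.∈-resp-↭ (↭-sym (Sym-↭ {n} π∈)) (∈-upTo⁺ k<n)

    π⁻¹-< : ∀ {k} → k < n → π⁻¹ k < n
    π⁻¹-< k<n = subst (_ <_) len (proj₁ (indexOf-< (∈π k<n)))

    π-π⁻¹ : ∀ {k} → k < n → nth π (π⁻¹ k) ≡ k
    π-π⁻¹ k<n = proj₂ (indexOf-< (∈π k<n))

    π⁻¹-π : ∀ {p} → p < n → π⁻¹ (nth π p) ≡ p
    π⁻¹-π p<n = indexOf-nth π-unique (subst (_ <_) (sym len) p<n)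

    inverse≡ : inverse π ≡ map π⁻¹ (upTo n)
    inverse≡ = cong (λ m → map π⁻¹ (upTo m)) len

    nth-inverse : ∀ {k} → k < n → nth (inverse π) k ≡ π⁻¹ k
    nth-inverse k<n = trans (cong (λ w → nth w _) inverse≡) (nth-map-upTo π⁻¹ k<n)

    length-inverse : length (inverse π) ≡ n
    length-inverse = trans (cong length inverse≡) (trans (length-map π⁻¹ (upTo n)) (length-upTo n))

    π⁻¹-injective : ∀ {k l} → k < n → l < n → π⁻¹ k ≡ π⁻¹ l → k ≡ l
    π⁻¹-injective k<n l<n eq = trans (sym (π-π⁻¹ k<n)) (trans (cong (nth π) eq) (π-π⁻¹ l<n))

    inverse-unique : Unique (inverse π)
    inverse-unique = subst Unique (sym (trans inverse≡ (map-upTo π⁻¹ n)))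
      (Unique.applyUpTo⁺₁ π⁻¹ n (λ k<l l<n eq → ℕ.<-irrefl (π⁻¹-injective (ℕ.<-trans k<l l<n) l<n eq) k<l))

    π≡ : map (nth π) (upTo n) ≡ π
    π≡ = trans (cong (λ m → map (nth π) (upTo m)) (sym len)) (map-nth π)

  -- Ranks.

  rank : ℕ → List ℕ → ℕ
  rank x []       = 0
  rank x (k ∷ ks) = ind (k <ᵇ x) + rank x ks

  standardize : List ℕ → List ℕ
  standardize ks = map (λ x → rank x ks) ks

  ind-≤1 : ∀ b → ind b ≤ 1
  ind-≤1 true  = s≤s z≤n
  ind-≤1 false = z≤n

  rank-↭ : ∀ x {ks ls} → ks ↭ ls → rank x ks ≡ rank x ls
  rank-↭ x _↭_.refl        = refl
  rank-↭ x (prep k p)      = cong (ind (k <ᵇ x) +_) (rank-↭ x p)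
  rank-↭ x (swap k l p)    = trans (x∙yz≈y∙xz (ind (k <ᵇ x)) (ind (l <ᵇ x)) _)
                               (cong (λ r → ind (l <ᵇ x) + (ind (k <ᵇ x) + r)) (rank-↭ x p))
  rank-↭ x (_↭_.trans p q) = trans (rank-↭ x p) (rank-↭ x q)

  rank-++ : ∀ x ks ls → rank x (ks ++ ls) ≡ rank x ks + rank x ls
  rank-++ x []       ls = refl
  rank-++ x (k ∷ ks) ls = trans (cong (ind (k <ᵇ x) +_) (rank-++ x ks ls)) (sym (ℕ.+-assoc (ind (k <ᵇ x)) _ _))

  rank-all : ∀ {x ks} → All (_< x) ks → rank x ks ≡ length ks
  rank-all []           = refl
  rank-all (k<x ∷ ks<x) = cong₂ _+_ (cong ind (<ᵇ-true k<x)) (rank-all ks<x)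

  rank-upTo : ∀ {v} n → v ≤ n → rank v (upTo n) ≡ v
  rank-upTo zero z≤n = refl
  rank-upTo {v} (suc n) v≤1+n with ℕ.m≤n⇒m<n∨m≡n v≤1+n
  ... | inj₂ refl      = trans (rank-all {ks = upTo (suc n)} (All.tabulate ∈-upTo⁻)) (length-upTo (suc n))
  ... | inj₁ (s≤s v≤n) = begin
    rank v (upTo (suc n))                    ≡⟨ cong (rank v) (upTo-∷ʳ n) ⟨
    rank v (upTo n ++ n ∷ [])                ≡⟨ rank-++ v (upTo n) (n ∷ []) ⟩
    rank v (upTo n) + (ind (n <ᵇ v) + 0)     ≡⟨ cong₂ (λ r b → r + (ind b + 0)) (rank-upTo n v≤n) (<ᵇ-false v≤n) ⟩
    v + 0                                    ≡⟨ ℕ.+-identityʳ v ⟩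
    v                                        ∎
    where open ≡-Reasoning

  ind-<ᵇ-mono : ∀ k {x y} → x ≤ y → ind (k <ᵇ x) ≤ ind (k <ᵇ y)
  ind-<ᵇ-mono k {x} {y} x≤y with k ℕ.<? x
  ... | yes k<x rewrite <ᵇ-true k<x | <ᵇ-true (ℕ.<-≤-trans k<x x≤y) = ℕ.≤-refl
  ... | no  k≮x rewrite <ᵇ-false (ℕ.≮⇒≥ k≮x) = z≤n

  rank-mono-≤ : ∀ ks {x y} → x ≤ y → rank x ks ≤ rank y ks
  rank-mono-≤ []       x≤y = z≤n
  rank-mono-≤ (k ∷ ks) x≤y = ℕ.+-mono-≤ (ind-<ᵇ-mono k x≤y) (rank-mono-≤ ks x≤y)

  rank-mono-< : ∀ {ks x y} → x ∈ ks → x < y → rank x ks < rank y ks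
  rank-mono-< {x ∷ ks} {_} {y} (here refl) x<y
    rewrite <ᵇ-false {x} ℕ.≤-refl | <ᵇ-true x<y = s≤s (rank-mono-≤ ks (ℕ.<⇒≤ x<y))
  rank-mono-< {k ∷ ks} (there x∈) x<y = ℕ.+-mono-≤-< (ind-<ᵇ-mono k (ℕ.<⇒≤ x<y)) (rank-mono-< x∈ x<y)

  rank-≤-length : ∀ x ks → rank x ks ≤ length ks
  rank-≤-length x []       = z≤n
  rank-≤-length x (k ∷ ks) = ℕ.+-mono-≤ (ind-≤1 (k <ᵇ x)) (rank-≤-length x ks)

  rank-<-length : ∀ {x ks} → x ∈ ks → rank x ks < length ks
  rank-<-length {x} {_ ∷ ks} (here refl) rewrite <ᵇ-false {x} ℕ.≤-refl = s≤s (rank-≤-length x ks)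
  rank-<-length {x} {k ∷ ks} (there x∈) = ℕ.+-mono-≤-< (ind-≤1 (k <ᵇ x)) (rank-<-length x∈)

  rank-reflect-< : ∀ ks {x y} → rank x ks < rank y ks → x < y
  rank-reflect-< ks {x} {y} r< with x ℕ.<? y
  ... | yes x<y = x<y
  ... | no  x≮y = ⊥-elim (ℕ.<⇒≱ r< (rank-mono-≤ ks (ℕ.≮⇒≥ x≮y)))

  unique-map-on : ∀ {A B : Set} {f : A → B} {xs} → (∀ {x y} → x ∈ xs → y ∈ xs → f x ≡ f y → x ≡ y) →
    Unique xs → Unique (map f xs)
  unique-map-on inj []             = []
  unique-map-on inj (x≢xs ∷ uniq) =
    All.map⁺ (All.tabulate (λ y∈ eq → All.lookup x≢xs y∈ (inj (here refl) (there y∈) eq))) ∷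
    unique-map-on (λ x∈ y∈ → inj (there x∈) (there y∈)) uniq

  standardize-∈-Sym : ∀ {ks} → Unique ks → standardize ks ∈ Sym (length ks)
  standardize-∈-Sym {ks} uniq = subst (λ m → standardize ks ∈ Sym m) len
    (∈-Sym⁺ (standardize ks) (subst (λ m → All (_< m) (standardize ks)) (sym len)
       (All.map⁺ (All.tabulate rank-<-length)))
     (unique-map-on rank-injective uniq))
    where
    len : length (standardize ks) ≡ length ks
    len = length-map _ ks
    rank-injective : ∀ {x y} → x ∈ ks → y ∈ ks → rank x ks ≡ rank y ks → x ≡ y
    rank-injective {x} {y} x∈ y∈ eq with ℕ.<-cmp x y
    ... | tri< x<y _ _ = ⊥-elim (ℕ.<-irrefl eq (rank-mono-< x∈ x<y))
    ... | tri≈ _ x≡y _ = x≡y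
    ... | tri> _ _ y<x = ⊥-elim (ℕ.<-irrefl (sym eq) (rank-mono-< y∈ y<x))

  -- Among the letters 0, ..., n-1 exactly x lie below x, so every letter is its own rank.
  standardize-Sym : ∀ {n π} → π ∈ Sym n → standardize π ≡ π
  standardize-Sym {n} {π} π∈ = map-id-local (All.tabulate (λ {x} x∈ →
    trans (rank-↭ x (Sym-↭ {n} π∈)) (rank-upTo n (ℕ.<⇒≤ (All.lookup (proj₁ (proj₂ (∈-Sym⁻ {n} π∈))) x∈)))))

  -- Ranks depend only on comparisons between entries.
  standardize-map : ∀ (f : ℕ → ℕ) ks → (∀ {x y} → x ∈ ks → y ∈ ks → (f x <ᵇ f y) ≡ (x <ᵇ y)) →
    standardize (map f ks) ≡ standardize ks
  standardize-map f ks mono = trans (sym (map-∘ ks)) (map-cong-local (All.tabulate (λ y∈ → go ks (λ x∈ → mono x∈ y∈))))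
    where
    go : ∀ {y} ls → (∀ {x} → x ∈ ls → (f x <ᵇ f y) ≡ (x <ᵇ y)) → rank (f y) (map f ls) ≡ rank y ls
    go []       h = refl
    go (l ∷ ls) h = cong₂ _+_ (cong ind (h (here refl))) (go ls (h ∘ there))

  -- Keys ordering the positions of a word.

  bound-≥ : ∀ d c → c ≤ bound d c
  bound-≥ true  c with odd c
  ... | true  = ℕ.n≤1+n c
  ... | false = ℕ.≤-refl
  bound-≥ false c with odd c
  ... | true  = ℕ.≤-refl
  ... | false = ℕ.n≤1+n c

  bound-≤ : ∀ d c → bound d c ≤ suc c
  bound-≤ true  c with odd c
  ... | true  = ℕ.≤-refl
  ... | false = ℕ.n≤1+n c
  bound-≤ false c with odd c
  ... | true  = ℕ.n≤1+n c
  ... | false = ℕ.≤-refl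

  module _ (M n : ℕ) where

    -- Comparing keys orders the positions p of a word by their letters c,
    -- breaking ties from left to right for plain and from right to left for barred letters.
    key : ℕ → ℕ → ℕ
    key c p = (M ∸ c) * suc n + (if odd c then n ∸ p else p)

    -- The tie-breaking offset is at most n, so the multiples of n + 1 decide between different
    -- letters. A smaller code is a larger letter and gets the larger multiple.
    key-letter : ∀ {c c′ p} q → c′ < c → c < M → p < n → key c p < key c′ q
    key-letter {c} {c′} {p} q c′<c c<M p<n = begin-strict
      (M ∸ c) * suc n + (if odd c then n ∸ p else p)  <⟨ ℕ.+-monoʳ-< ((M ∸ c) * suc n) (offset-< c) ⟩
      (M ∸ c) * suc n + suc n                         ≡⟨ ℕ.+-comm _ (suc n) ⟩
      suc (M ∸ c) * suc n                             ≤⟨ ℕ.*-monoˡ-≤ (suc n) (ℕ.∸-monoʳ-< c′<c (ℕ.<⇒≤ c<M)) ⟩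
      (M ∸ c′) * suc n                                ≤⟨ ℕ.m≤m+n _ _ ⟩
      key c′ q                                        ∎
      where
      open ℕ.≤-Reasoning
      offset-< : ∀ c → (if odd c then n ∸ p else p) < suc n
      offset-< c with odd c
      ... | true  = s≤s (ℕ.m∸n≤m n p)
      ... | false = ℕ.m≤n⇒m≤1+n p<n

    -- Links sorting to compatibility. Different letters are settled by `key-letter`, as `bound`
    -- exceeds c by at most one; for equal letters the tie rule puts p before q exactly when `bound`
    -- permits a repetition.
    key-step : ∀ {c c′ p q} → c < M → c′ < M → p < n → q < n → p ≢ q →
      (key c p <ᵇ key c′ q) ≡ (c′ <ᵇ bound (q <ᵇ p) c)
    key-step {c} {c′} {p} {q} c<M c′<M p<n q<n p≢q with ℕ.<-cmp c c′
    ... | tri< c<c′ _ _ = trans (<ᵇ-false (ℕ.<⇒≤ (key-letter p c<c′ c′<M q<n)))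
                            (sym (<ᵇ-false (ℕ.≤-trans (bound-≤ (q <ᵇ p) c) c<c′)))
    ... | tri> _ _ c′<c = trans (<ᵇ-true (key-letter q c′<c c<M p<n))
                            (sym (<ᵇ-true (ℕ.<-≤-trans c′<c (bound-≥ (q <ᵇ p) c))))
    ... | tri≈ _ refl _ with ℕ.<-cmp p q | odd c in parity
    ...   | tri≈ _ p≡q _ | _     = ⊥-elim (p≢q p≡q)
    ...   | tri< p<q _ _ | true  rewrite <ᵇ-false (ℕ.<⇒≤ p<q) =
      trans (<ᵇ-false (ℕ.+-monoʳ-≤ ((M ∸ c) * suc n) (ℕ.∸-monoʳ-≤ n (ℕ.<⇒≤ p<q)))) (sym (<ᵇ-false {c} ℕ.≤-refl))
    ...   | tri< p<q _ _ | false rewrite <ᵇ-false (ℕ.<⇒≤ p<q) =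
      trans (<ᵇ-true (ℕ.+-monoʳ-< ((M ∸ c) * suc n) p<q)) (sym (<ᵇ-true {c} ℕ.≤-refl))
    ...   | tri> _ _ q<p | true  rewrite <ᵇ-true q<p =
      trans (<ᵇ-true (ℕ.+-monoʳ-< ((M ∸ c) * suc n) (ℕ.∸-monoʳ-< q<p (ℕ.<⇒≤ p<n)))) (sym (<ᵇ-true {c} ℕ.≤-refl))
    ...   | tri> _ _ q<p | false rewrite <ᵇ-true q<p =
      trans (<ᵇ-false (ℕ.+-monoʳ-≤ ((M ∸ c) * suc n) (ℕ.<⇒≤ q<p))) (sym (<ᵇ-false {c} ℕ.≤-refl))

    key-injective : ∀ {c c′ p q} → c < M → c′ < M → p < n → q < n → key c p ≡ key c′ q → p ≡ q
    key-injective {c} {c′} {p} {q} c<M c′<M p<n q<n eq with ℕ.<-cmp c c′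
    ... | tri< c<c′ _ _ = ⊥-elim (ℕ.<-irrefl (sym eq) (key-letter p c<c′ c′<M q<n))
    ... | tri> _ _ c′<c = ⊥-elim (ℕ.<-irrefl eq (key-letter q c′<c c<M p<n))
    ... | tri≈ _ refl _ with odd c
    ...   | true  = ℕ.∸-cancelˡ-≡ (ℕ.<⇒≤ p<n) (ℕ.<⇒≤ q<n) (ℕ.+-cancelˡ-≡ ((M ∸ c) * suc n) _ _ eq)
    ...   | false = ℕ.+-cancelˡ-≡ ((M ∸ c) * suc n) _ _ eq

    keys : List ℕ → List ℕ
    keys w = map (λ p → key (nth w p) p) (upTo n)

  -- Compatibility of a sequence with a descent pattern.

  headBelow : ℕ → List ℕ → Bool
  headBelow b []      = true
  headBelow b (c ∷ _) = c <ᵇ b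

  compatible : List Bool → List ℕ → Bool
  compatible (d ∷ ds) (c ∷ g) = headBelow (bound d c) g ∧ compatible ds g
  compatible _        _       = true

  StepCompatible : List ℕ → List ℕ → ℕ → Set
  StepCompatible τ g k = (nth g (suc k) <ᵇ bound (nth τ (suc k) <ᵇ nth τ k) (nth g k)) ≡ true

  compatible⁻ : ∀ τ g → length g ≡ length τ → T (compatible (pat τ) g) → ∀ {k} → suc k < length τ → StepCompatible τ g k
  compatible⁻ (a ∷ [])    g             len t         (s≤s ())
  compatible⁻ (a ∷ b ∷ τ) (c ∷ c′ ∷ g)  len t {zero}  _ = Equivalence.to T-≡ (proj₁ (Equivalence.to T-∧ t))
  compatible⁻ (a ∷ b ∷ τ) (c ∷ c′ ∷ g)  len t {suc k} (s≤s k<) =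
    compatible⁻ (b ∷ τ) (c′ ∷ g) (ℕ.suc-injective len) (proj₂ (Equivalence.to T-∧ t)) k<

  compatible⁺ : ∀ τ g → length g ≡ length τ → (∀ {k} → suc k < length τ → StepCompatible τ g k) → T (compatible (pat τ) g)
  compatible⁺ []          _            _   _ = tt
  compatible⁺ (a ∷ [])    (c ∷ [])     _   _ = tt
  compatible⁺ (a ∷ b ∷ τ) (c ∷ c′ ∷ g) len h = Equivalence.from T-∧
    (Equivalence.from T-≡ (h {0} (s≤s (s≤s z≤n))) ,
     compatible⁺ (b ∷ τ) (c′ ∷ g) (ℕ.suc-injective len) (λ k< → h (s≤s k<)))

  pattern-ext : ∀ {D D′} u v → length u ≡ length v →
    (∀ {k} → suc k < length u → D (nth u k) (nth u (suc k)) ≡ D′ (nth v k) (nth v (suc k))) → stepPattern D u ≡ stepPattern D′ v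
  pattern-ext []          []            _   _ = refl
  pattern-ext (a ∷ [])    (c ∷ [])      _   _ = refl
  pattern-ext (a ∷ b ∷ u) (c ∷ c′ ∷ v)  len h =
    cong₂ _∷_ (h {0} (s≤s (s≤s z≤n))) (pattern-ext (b ∷ u) (c′ ∷ v) (ℕ.suc-injective len) (λ k< → h (s≤s k<)))

  -- In `pattern-w` the key of the later position stands on the left, so `bound` acts on the
  -- right-hand letter; its flag `true` makes a tie a descent exactly for barred letters.
  <ᵇ-bound-true : ∀ a b → (a <ᵇ bound true b) ≡ superDescends a b
  <ᵇ-bound-true a b with ℕ.<-cmp a b
  ... | tri< a<b a≢b _ rewrite ≡ᵇ-false a≢b | <ᵇ-true a<b = <ᵇ-true (ℕ.<-≤-trans a<b (bound-≥ true b))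
  ... | tri> _ a≢b b<a rewrite ≡ᵇ-false a≢b | <ᵇ-false (ℕ.<⇒≤ b<a) = <ᵇ-false (ℕ.≤-trans (bound-≤ true b) b<a)
  ... | tri≈ _ refl _ rewrite ≡ᵇ-refl a with odd a
  ...   | true  = <ᵇ-true {a} ℕ.≤-refl
  ...   | false = <ᵇ-false {a} ℕ.≤-refl

  -- The bijection between words and compatible pairs.

  module Standardization (M n : ℕ) where

    -- For a compatible pair, g lists the letters in the order of their keys and π sends a position
    -- to its place in that order.
    compose : List ℕ × List ℕ → List ℕ
    compose (π , g) = map (nth g) π

    decompose : List ℕ → List ℕ × List ℕ
    decompose w = let π = standardize (keys M n w) in π , map (nth w) (inverse π)

    compatiblePair : List ℕ × List ℕ → Bool
    compatiblePair (π , g) = compatible (pat (inverse π)) g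

    pairs : List (List ℕ × List ℕ)
    pairs = filterᵇ compatiblePair (cartesianProduct (Sym n) (words M n))

    pairs-unique : Unique pairs
    pairs-unique = Unique.filter⁺ (T? ∘ compatiblePair) (Unique.cartesianProduct⁺ (Sym-unique n) (words-unique M n))

    ∈-pairs⁺ : ∀ {π g} → π ∈ Sym n → g ∈ words M n → T (compatiblePair (π , g)) → (π , g) ∈ pairs
    ∈-pairs⁺ π∈ g∈ t = ∈-filter⁺ (T? ∘ compatiblePair) (∈-cartesianProduct⁺ π∈ g∈) t

    module Compatible {π g} (π∈ : π ∈ Sym n) (g∈ : g ∈ words M n) where
      open Permutation {n} π∈ public

      len-π : length π ≡ n
      len-π = proj₁ (∈-Sym⁻ {n} π∈)

      len-g : length g ≡ n
      len-g = proj₁ (∈-words⁻ n g∈)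

      g-< : ∀ {k} → k < n → nth g k < M
      g-< k<n = All.lookup (proj₂ (∈-words⁻ n g∈)) (nth-∈ g (subst (_ <_) (sym len-g) k<n))

      w : List ℕ
      w = compose (π , g)

      len-w : length w ≡ n
      len-w = trans (length-map (nth g) π) len-π

      nth-w : ∀ {p} → p < n → nth w p ≡ nth g (nth π p)
      nth-w p<n = nth-map (nth g) π (subst (_ <_) (sym len-π) p<n)

      -- The keys of the composed word, listed in the order that π prescribes. By `K-step`,
      -- compatibility of g says precisely that this list increases.
      K : ℕ → ℕ
      K k = key M n (nth g k) (π⁻¹ k)

      K-step : ∀ {k} → suc k < n → (K k <ᵇ K (suc k)) ≡ (nth g (suc k) <ᵇ bound (nth (inverse π) (suc k) <ᵇ nth (inverse π) k) (nth g k))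
      K-step {k} 1+k<n = trans
        (key-step M n (g-< k<n) (g-< 1+k<n) (π⁻¹-< k<n) (π⁻¹-< 1+k<n)
          (λ eq → ℕ.<-irrefl (π⁻¹-injective k<n 1+k<n eq) ℕ.≤-refl))
        (cong₂ (λ q p → nth g (suc k) <ᵇ bound (q <ᵇ p) (nth g k)) (sym (nth-inverse 1+k<n)) (sym (nth-inverse k<n)))
        where
        k<n : k < n
        k<n = ℕ.<-trans ℕ.≤-refl 1+k<n

      K-π : ∀ {p} → p < n → key M n (nth w p) p ≡ K (nth π p)
      K-π p<n = cong₂ (key M n) (nth-w p<n) (sym (π⁻¹-π p<n))

      keys-w : keys M n w ≡ map K π
      keys-w = trans (map-upTo-cong n (λ p → K-π)) (trans (map-∘ (upTo n)) (cong (map K) π≡))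

      module _ (t : T (compatiblePair (π , g))) where

        K-suc : ∀ {k} → suc k < n → K k < K (suc k)
        K-suc {k} 1+k<n = ℕ.<ᵇ⇒< (K k) (K (suc k)) (Equivalence.from T-≡ (trans (K-step 1+k<n)
          (compatible⁻ (inverse π) g (trans len-g (sym length-inverse)) t (subst (_ <_) (sym length-inverse) 1+k<n))))

        K-mono : ∀ {k} l → k < l → l < n → K k < K l
        K-mono {k} (suc l) (s≤s k≤l) 1+l<n with ℕ.m≤n⇒m<n∨m≡n k≤l
        ... | inj₁ k<l  = ℕ.<-trans (K-mono l k<l (ℕ.<-trans ℕ.≤-refl 1+l<n)) (K-suc 1+l<n)
        ... | inj₂ refl = K-suc 1+l<n

        K-reflect : ∀ {x y} → x < n → y < n → (K x <ᵇ K y) ≡ (x <ᵇ y)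
        K-reflect {x} {y} x<n y<n with ℕ.<-cmp x y
        ... | tri< x<y _ _  = trans (<ᵇ-true (K-mono y x<y y<n)) (sym (<ᵇ-true x<y))
        ... | tri≈ _ refl _ = trans (<ᵇ-false {K x} ℕ.≤-refl) (sym (<ᵇ-false {x} ℕ.≤-refl))
        ... | tri> _ _ y<x  = trans (<ᵇ-false (ℕ.<⇒≤ (K-mono x y<x x<n))) (sym (<ᵇ-false (ℕ.<⇒≤ y<x)))

        -- The keys of the word are π with the increasing map K applied, and a permutation is its
        -- own standardization.
        standardize-w : standardize (keys M n w) ≡ π
        standardize-w = trans (cong standardize keys-w) (trans
          (standardize-map K π (λ x∈ y∈ → K-reflect (π-bound x∈) (π-bound y∈))) (standardize-Sym {n} π∈))
          where
          π-bound : ∀ {x} → x ∈ π → x < n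
          π-bound = All.lookup (proj₁ (proj₂ (∈-Sym⁻ {n} π∈)))

        decompose-compose : decompose w ≡ (π , g)
        decompose-compose = trans (cong (λ σ → σ , map (nth w) (inverse σ)) standardize-w) (cong (π ,_) (begin
          map (nth w) (inverse π)            ≡⟨ cong (map (nth w)) inverse≡ ⟩
          map (nth w) (map π⁻¹ (upTo n))     ≡⟨ map-∘ (upTo n) ⟨
          map (nth w ∘ π⁻¹) (upTo n)         ≡⟨ map-upTo-cong n (λ k k<n → trans (nth-w (π⁻¹-< k<n)) (cong (nth g) (π-π⁻¹ k<n))) ⟩
          map (nth g) (upTo n)               ≡⟨ cong (map (nth g) ∘ upTo) len-g ⟨
          map (nth g) (upTo (length g))      ≡⟨ map-nth g ⟩
          g                                  ∎))
          where open ≡-Reasoning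

        -- As K preserves order, descents of π are descents of the keys at adjacent positions;
        -- `key-step` reads these off from the two letters, the positions being always in the order
        -- k, k + 1.
        pattern-w : pat π ≡ spat w
        pattern-w = pattern-ext π w (trans len-π (sym len-w)) λ {k} 1+k<len →
          let 1+k<n = subst (suc k <_) len-π 1+k<len
              k<n   = ℕ.<-trans ℕ.≤-refl 1+k<n
          in begin
          (nth π (suc k) <ᵇ nth π k)
            ≡⟨ K-reflect (π-< 1+k<n) (π-< k<n) ⟨
          (K (nth π (suc k)) <ᵇ K (nth π k))
            ≡⟨ cong₂ _<ᵇ_ (K-π 1+k<n) (K-π k<n) ⟨
          (key M n (nth w (suc k)) (suc k) <ᵇ key M n (nth w k) k)
            ≡⟨ key-step M n (w-< 1+k<n) (w-< k<n) 1+k<n k<n (λ ()) ⟩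
          (nth w k <ᵇ bound (k <ᵇ suc k) (nth w (suc k)))
            ≡⟨ cong (λ b → nth w k <ᵇ bound b (nth w (suc k))) (<ᵇ-true {k} ℕ.≤-refl) ⟩
          (nth w k <ᵇ bound true (nth w (suc k)))
            ≡⟨ <ᵇ-bound-true (nth w k) (nth w (suc k)) ⟩
          superDescends (nth w k) (nth w (suc k)) ∎
          where
          open ≡-Reasoning
          w-< : ∀ {p} → p < n → nth w p < M
          w-< p<n = subst (_< M) (sym (nth-w p<n)) (g-< (π-< p<n))

      compose-∈ : compose (π , g) ∈ words M n
      compose-∈ = subst (λ m → w ∈ words M m) len-w (∈-words⁺ w (All.map⁺ (All.map g-< (proj₁ (proj₂ (∈-Sym⁻ {n} π∈))))))

      -- Used to give the word and its sorted sequence the same weight.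
      compose-↭ : compose (π , g) ↭ g
      compose-↭ = ↭-trans (↭.map⁺ (nth g) (Sym-↭ {n} π∈))
        (↭-reflexive (trans (cong (map (nth g) ∘ upTo) (sym len-g)) (map-nth g)))

    module _ {w} (w∈ : w ∈ words M n) where
      private
        len : length w ≡ n
        len = proj₁ (∈-words⁻ n w∈)

        w-< : ∀ {p} → p < n → nth w p < M
        w-< p<n = All.lookup (proj₂ (∈-words⁻ n w∈)) (nth-∈ w (subst (_ <_) (sym len) p<n))

        ks = keys M n w
        π = standardize ks
        g = map (nth w) (inverse π)

        len-ks : length ks ≡ n
        len-ks = trans (length-map _ (upTo n)) (length-upTo n)

        ks-unique : Unique ks
        ks-unique = unique-map-on (λ p∈ q∈ → key-injective M n (w-< (∈-upTo⁻ p∈)) (w-< (∈-upTo⁻ q∈)) (∈-upTo⁻ p∈) (∈-upTo⁻ q∈))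
          (Unique.upTo⁺ n)

        π∈ : π ∈ Sym n
        π∈ = subst (λ m → π ∈ Sym m) len-ks (standardize-∈-Sym ks-unique)

        open Permutation {n} π∈

        g≡ : g ≡ map (nth w ∘ π⁻¹) (upTo n)
        g≡ = trans (cong (map (nth w)) inverse≡) (sym (map-∘ (upTo n)))

        nth-g : ∀ {k} → k < n → nth g k ≡ nth w (π⁻¹ k)
        nth-g k<n = trans (cong (λ v → nth v _) g≡) (nth-map-upTo (nth w ∘ π⁻¹) k<n)

        len-g : length g ≡ n
        len-g = trans (length-map (nth w) (inverse π)) length-inverse

        g∈ : g ∈ words M n
        g∈ = subst (λ m → g ∈ words M m) len-g (∈-words⁺ g (subst (All (_< M)) (sym g≡)
          (All.map⁺ (All.tabulate (λ k∈ → w-< (π⁻¹-< (∈-upTo⁻ k∈)))))))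

        module C = Compatible π∈ g∈

        -- Here π sends a position to the rank of its key, so the key at π⁻¹ k has rank k.
        -- Consecutive ranks then force K to increase, which is compatibility.
        rank-K : ∀ {k} → k < n → rank (C.K k) ks ≡ k
        rank-K {k} k<n = begin
          rank (C.K k) ks                                   ≡⟨ cong (λ c → rank (key M n c (π⁻¹ k)) ks) (nth-g k<n) ⟩
          rank (key M n (nth w (π⁻¹ k)) (π⁻¹ k)) ks         ≡⟨ cong (λ x → rank x ks) (nth-map-upTo (λ p → key M n (nth w p) p) (π⁻¹-< k<n)) ⟨
          rank (nth ks (π⁻¹ k)) ks                          ≡⟨ nth-map (λ x → rank x ks) ks (subst (π⁻¹ k <_) (sym len-ks) (π⁻¹-< k<n)) ⟨
          nth π (π⁻¹ k)                                     ≡⟨ π-π⁻¹ k<n ⟩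
          k                                                 ∎
          where open ≡-Reasoning

        K-increases : ∀ {k} → suc k < n → C.K k < C.K (suc k)
        K-increases 1+k<n = rank-reflect-< ks
          (subst₂ _<_ (sym (rank-K (ℕ.<-trans ℕ.≤-refl 1+k<n))) (sym (rank-K 1+k<n)) ℕ.≤-refl)

      decompose-∈ : decompose w ∈ pairs
      decompose-∈ = ∈-pairs⁺ π∈ g∈ (compatible⁺ (inverse π) g (trans len-g (sym length-inverse)) (λ 1+k<len →
        let 1+k<n = subst (_ <_) length-inverse 1+k<len in
        trans (sym (C.K-step 1+k<n)) (<ᵇ-true (K-increases 1+k<n))))

      compose-decompose : compose (decompose w) ≡ w
      compose-decompose = begin
        map (nth g) π                      ≡⟨ cong (map (nth g)) π≡ ⟨
        map (nth g) (map (nth π) (upTo n)) ≡⟨ map-∘ (upTo n) ⟨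
        map (nth g ∘ nth π) (upTo n)       ≡⟨ map-upTo-cong n (λ p p<n → trans (nth-g (π-< p<n)) (cong (nth w) (π⁻¹-π p<n))) ⟩
        map (nth w) (upTo n)               ≡⟨ cong (map (nth w) ∘ upTo) len ⟨
        map (nth w) (upTo (length w))      ≡⟨ map-nth w ⟩
        w                                  ∎
        where open ≡-Reasoning

    ∈-pairs⁻ : ∀ {π g} → (π , g) ∈ pairs → π ∈ Sym n × g ∈ words M n × T (compatiblePair (π , g))
    ∈-pairs⁻ πg∈ with ∈× , t ← ∈-filter⁻ (T? ∘ compatiblePair) πg∈
                 with π∈ , g∈ ← ∈-cartesianProduct⁻ (Sym n) (words M n) ∈× = π∈ , g∈ , t

    -- The bijection in list form: `compose` and `decompose` are mutually inverse, so both lists are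
    -- free of repetitions and have the same members.
    compose-pairs : map compose pairs ↭ words M n
    compose-pairs = ∼bag⇒↭ (unique∧set⇒bag
      (unique-map-on (λ x∈ y∈ eq → trans (sym (inverted x∈)) (trans (cong decompose eq) (inverted y∈))) pairs-unique)
      (words-unique M n)
      (mk⇔ to (λ w∈ → subst (_∈ map compose pairs) (compose-decompose w∈) (∈-map⁺ compose (decompose-∈ w∈)))))
      where
      inverted : ∀ {x} → x ∈ pairs → decompose (compose x) ≡ x
      inverted x∈ with π∈ , g∈ , t ← ∈-pairs⁻ x∈ = Compatible.decompose-compose π∈ g∈ t
      to : ∀ {w} → w ∈ map compose pairs → w ∈ words M n
      to w∈ with x , x∈ , refl ← ∈-map⁻ compose w∈ with π∈ , g∈ , _ ← ∈-pairs⁻ x∈ = Compatible.compose-∈ π∈ g∈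

-- Summation over biwords

module Sums {c ℓ} (R : CommutativeRing c ℓ) where
  open CommutativeRing R hiding (zero)
  open CommutativeSemigroupProperties +-commutativeSemigroup using (interchange; xy∙z≈xz∙y; x∙yz≈y∙xz)

  Σ : {A : Set} → List A → (A → Carrier) → Carrier
  Σ []       f = 0#
  Σ (a ∷ as) f = f a + Σ as f

  module _ {A : Set} where
    Σ-cong : ∀ (as : List A) {f g} → (∀ a → f a ≈ g a) → Σ as f ≈ Σ as g
    Σ-cong []       h = refl
    Σ-cong (a ∷ as) h = +-cong (h a) (Σ-cong as h)

    Σ-+ : ∀ (as : List A) f g → Σ as (λ a → f a + g a) ≈ Σ as f + Σ as g
    Σ-+ []       f g = sym (+-identityˡ _)
    Σ-+ (a ∷ as) f g = trans (+-congˡ (Σ-+ as f g)) (interchange _ _ _ _)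

    Σ-*ˡ : ∀ (as : List A) x f → Σ as (λ a → x * f a) ≈ x * Σ as f
    Σ-*ˡ []       x f = sym (zeroʳ x)
    Σ-*ˡ (a ∷ as) x f = trans (+-congˡ (Σ-*ˡ as x f)) (sym (distribˡ _ _ _))

    Σ-++ : ∀ (as bs : List A) f → Σ (as ++ bs) f ≈ Σ as f + Σ bs f
    Σ-++ []       bs f = sym (+-identityˡ _)
    Σ-++ (a ∷ as) bs f = trans (+-congˡ (Σ-++ as bs f)) (sym (+-assoc _ _ _))

    Σ-0 : ∀ (as : List A) {f} → (∀ a → f a ≈ 0#) → Σ as f ≈ 0#
    Σ-0 []       h = refl
    Σ-0 (a ∷ as) h = trans (+-cong (h a) (Σ-0 as h)) (+-identityˡ _)

  Σ-map : ∀ {A B : Set} (h : A → B) as f → Σ (map h as) f ≈ Σ as (λ a → f (h a))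
  Σ-map h []       f = refl
  Σ-map h (a ∷ as) f = +-congˡ (Σ-map h as f)

  Σ-concatMap : ∀ {A B : Set} (h : A → List B) as f → Σ (concatMap h as) f ≈ Σ as (λ a → Σ (h a) f)
  Σ-concatMap h []       f = refl
  Σ-concatMap h (a ∷ as) f = trans (Σ-++ (h a) _ f) (+-congˡ (Σ-concatMap h as f))

  Σ-words : ∀ M n f → Σ (words M (suc n)) f ≈ Σ (upTo M) (λ b → Σ (words M n) (λ w → f (b ∷ w)))
  Σ-words M n f = trans (Σ-concatMap _ (upTo M) f) (Σ-cong (upTo M) (λ b → Σ-map (b ∷_) (words M n) f))

  sumBelow : ℕ → (ℕ → Carrier) → Carrier
  sumBelow zero    f = 0#
  sumBelow (suc M) f = sumBelow M f + f M

  Σ-upTo : ∀ M f → Σ (upTo M) f ≈ sumBelow M f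
  Σ-upTo zero    f = refl
  Σ-upTo (suc M) f = trans (reflexive (≡.cong (λ bs → Σ bs f) (≡.sym (upTo-∷ʳ M))))
    (trans (Σ-++ (upTo M) (M ∷ []) f) (+-cong (Σ-upTo M f) (+-identityʳ _)))

  sumBelow-cong : ∀ M {f g} → (∀ b → b < M → f b ≈ g b) → sumBelow M f ≈ sumBelow M g
  sumBelow-cong zero    h = refl
  sumBelow-cong (suc M) h = +-cong (sumBelow-cong M (λ b b<M → h b (ℕ.m≤n⇒m≤1+n b<M))) (h M ℕ.≤-refl)

  sumBelow-update : ∀ M {f g} k x → k < M → f k ≈ g k + x → (∀ b → b ≢ k → f b ≈ g b) →
    sumBelow M f ≈ sumBelow M g + x
  sumBelow-update (suc M) {f} {g} k x k<1+M at-k off-k with ℕ.m≤n⇒m<n∨m≡n k<1+M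
  ... | inj₁ (s≤s k<M) = trans
    (+-cong (sumBelow-update M k x k<M at-k off-k) (off-k M λ M≡k → ℕ.<-irrefl (≡.sym M≡k) k<M))
    (xy∙z≈xz∙y _ _ _)
  ... | inj₂ ≡.refl = trans
    (+-cong (sumBelow-cong M (λ b b<M → off-k b λ b≡k → ℕ.<-irrefl b≡k b<M)) at-k)
    (sym (+-assoc _ _ _))

  Σ-cong-∈ : ∀ {A : Set} (as : List A) {f g} → (∀ {a} → a ∈ as → f a ≈ g a) → Σ as f ≈ Σ as g
  Σ-cong-∈ []       h = refl
  Σ-cong-∈ (a ∷ as) h = +-cong (h (here ≡.refl)) (Σ-cong-∈ as (λ a∈ → h (there a∈)))

  Σ-↭ : ∀ {A : Set} {as bs : List A} f → as ↭ bs → Σ as f ≈ Σ bs f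
  Σ-↭ f _↭_.refl        = refl
  Σ-↭ f (prep a p)      = +-congˡ (Σ-↭ f p)
  Σ-↭ f (swap a b p)    = trans (x∙yz≈y∙xz _ _ _) (+-congˡ (+-congˡ (Σ-↭ f p)))
  Σ-↭ f (_↭_.trans p q) = trans (Σ-↭ f p) (Σ-↭ f q)

  Σ-filterᵇ : ∀ {A : Set} (p : A → Bool) as f → Σ (filterᵇ p as) f ≈ Σ as (λ a → if p a then f a else 0#)
  Σ-filterᵇ p []       f = refl
  Σ-filterᵇ p (a ∷ as) f with p a
  ... | true  = +-congˡ (Σ-filterᵇ p as f)
  ... | false = trans (Σ-filterᵇ p as f) (sym (+-identityˡ _))

  Σ-cartesianProduct : ∀ {A B : Set} (as : List A) (bs : List B) f →
    Σ (cartesianProduct as bs) f ≈ Σ as (λ a → Σ bs (λ b → f (a , b)))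
  Σ-cartesianProduct []       bs f = refl
  Σ-cartesianProduct (a ∷ as) bs f = trans (Σ-++ (map (a ,_) bs) _ f)
    (+-cong (Σ-map (a ,_) bs f) (Σ-cartesianProduct as bs f))

  sumBelow-extend : ∀ {b M} f → b ≤ M → sumBelow b f ≈ sumBelow M (λ c → if c <ᵇ b then f c else 0#)
  sumBelow-extend {b} {zero}  f z≤n = refl
  sumBelow-extend {b} {suc M} f b≤1+M with ℕ.m≤n⇒m<n∨m≡n b≤1+M
  ... | inj₁ (s≤s b≤M) = trans (sumBelow-extend f b≤M) (sym (trans
          (+-congˡ (reflexive (≡.cong (λ s → if s then f M else 0#) (<ᵇ-false b≤M)))) (+-identityʳ _)))
  ... | inj₂ ≡.refl = sumBelow-cong (suc M) (λ c c<b →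
          reflexive (≡.cong (λ s → if s then f c else 0#) (≡.sym (<ᵇ-true c<b))))

-- The product over the cells.

module CellProduct {c ℓ} (R : CommutativeRing c ℓ) (y z : CommutativeRing.Carrier R) where
  open CommutativeRing R hiding (zero)
  open Series R
  open PowerSeries R
  open Counting R
  open Sums R
  private module P = CommutativeRing psRing

  wordWeight : List ℕ → Carrier
  wordWeight []      = 1#
  wordWeight (b ∷ w) = weight z b * wordWeight w

  headDescends : ℕ → List ℕ → Bool
  headDescends b []       = false
  headDescends b (b′ ∷ _) = superDescends b b′

  -- As N y (spat w) (suc m), except that the first letter of w
  -- may be matched with the letter m only if it satisfies S.
  restricted : ℕ → (ℕ → Bool) → List ℕ → Carrier
  restricted m S []      = 1#
  restricted m S (b ∷ w) = N y (spat (b ∷ w)) m +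
    (if S b then weight y m * N y (spat w) (bound (headDescends b w) m) else 0#)

  repeats : ℕ → ℕ → ℕ → Bool
  repeats m b b′ = if odd m then superDescends b b′ else not (superDescends b b′)

  N-suc : ∀ m w → N y (spat w) (suc m) ≈ restricted m (λ _ → true) w
  N-suc m []           = refl
  N-suc m (b ∷ [])     = refl
  N-suc m (b ∷ b′ ∷ w) = refl

  N-≈-restricted : ∀ m w → N y (spat w) m ≈ restricted m (λ _ → false) w
  N-≈-restricted m []      = refl
  N-≈-restricted m (b ∷ w) = sym (+-identityʳ _)

  bound-repeats : ∀ m b b′ → bound (superDescends b b′) m ≡ (if repeats m b b′ then suc m else m)
  bound-repeats m b b′ with odd m | superDescends b b′
  ... | true  | true  = ≡.refl
  ... | true  | false = ≡.refl
  ... | false | true  = ≡.refl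
  ... | false | false = ≡.refl

  -- Once b is matched with m, the next letter may be matched with m again iff the step from b to it
  -- satisfies `repeats m b`. The remaining sum is therefore of the same kind, with a new set S.
  N-bound : ∀ m b w → N y (spat w) (bound (headDescends b w) m) ≈ restricted m (repeats m b) w
  N-bound m b []       = refl
  N-bound m b (b′ ∷ w) rewrite bound-repeats m b b′ with repeats m b b′
  ... | true  = N-suc m (b′ ∷ w)
  ... | false = N-≈-restricted m (b′ ∷ w)

  below above : ℕ → ℕ → Bool
  below k b = b <ᵇ k
  above k b = not (b <ᵇ k)

  onePlus-⊗₁ : ∀ a f → add f (shift (scale a f)) ≋ onePlus₁ a ⊗₁ f
  onePlus-⊗₁ a f = P.sym (P.trans
    (⊗₁-cong {onePlus₁ a} {add δ (constant a ⊗₁ X)} {f} {f} split (λ _ → refl))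
    (P.trans (⊗₁-distribʳ f δ (constant a ⊗₁ X))
      (P.+-cong (⊗₁-identityˡ f) (P.trans (⊗₁-cong {g = f} (⊗₁-comm (constant a) X) (λ _ → refl))
        (P.trans (⊗₁-assoc X (constant a) f) (P.trans (X-⊗₁ _) (shift-cong (constant-⊗₁ a f))))))))
    where
    shift-cong : ∀ {f g} → f ≋ g → shift f ≋ shift g
    shift-cong p zero    = refl
    shift-cong p (suc k) = p k
    split : onePlus₁ a ≋ add δ (constant a ⊗₁ X)
    split k = trans (lemma k) (+-congˡ (sym (constant-⊗₁ a X k)))
      where
      lemma : ∀ k → onePlus₁ a k ≈ δ k + a * X k
      lemma zero          = sym (trans (+-congˡ (zeroʳ a)) (+-identityʳ _))
      lemma (suc zero)    = sym (trans (+-identityˡ _) (*-identityʳ a))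
      lemma (suc (suc k)) = sym (trans (+-identityˡ _) (zeroʳ a))

  -- The equation g = f + axg determines g coefficient by coefficient, and f/(1-ax) satisfies it.
  geom-⊗₁ : ∀ a f g → g ≋ add f (shift (scale a g)) → g ≋ geom₁ a ⊗₁ f
  geom-⊗₁ a f g h zero    = trans (h 0) (trans (+-identityʳ _) (sym (*-identityˡ _)))
  geom-⊗₁ a f g h (suc k) = begin
    g (suc k)                                      ≈⟨ h (suc k) ⟩
    f (suc k) + a * g k                            ≈⟨ +-cong (sym (*-identityˡ _)) (*-congˡ (geom-⊗₁ a f g h k)) ⟩
    1# * f (suc k) + a * (geom₁ a ⊗₁ f) k          ≈⟨ +-congˡ (⊗₁-scale a (geom₁ a) f k) ⟨
    1# * f (suc k) + (scale a (geom₁ a) ⊗₁ f) k    ≈⟨ ⊗₁-unfoldˡ (geom₁ a) f k ⟨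
    (geom₁ a ⊗₁ f) (suc k)                         ∎
    where open SetoidReasoning setoid

  module _ (M : ℕ) where
    open SetoidReasoning setoid

    -- Interpolates between `wordSeries m`, for S empty, and `wordSeries (suc m)`, for S full, so
    -- that row m can be filled one cell at a time.
    rowSeries : ℕ → (ℕ → Bool) → PS1
    rowSeries m S n = Σ (words M n) (λ w → wordWeight w * restricted m S w)

    wordSeries : ℕ → PS1
    wordSeries m n = Σ (words M n) (λ w → wordWeight w * N y (spat w) m)

    wordSeries-0 : wordSeries 0 ≋ δ
    wordSeries-0 zero    = trans (+-identityʳ _) (*-identityˡ _)
    wordSeries-0 (suc n) = trans (Σ-words M n _) (Σ-0 (upTo M) (λ b → Σ-0 (words M n) (λ w →
      trans (*-congˡ (N-cons b w)) (zeroʳ _))))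
      where
      N-cons : ∀ b w → N y (spat (b ∷ w)) 0 ≈ 0#
      N-cons b []       = refl
      N-cons b (b′ ∷ w) = refl

    rowSeries-true : ∀ m → rowSeries m (λ _ → true) ≋ wordSeries (suc m)
    rowSeries-true m n = Σ-cong (words M n) (λ w → *-congˡ (sym (N-suc m w)))

    rowSeries-false : ∀ m → rowSeries m (λ _ → false) ≋ wordSeries m
    rowSeries-false m n = Σ-cong (words M n) (λ w → *-congˡ (sym (N-≈-restricted m w)))

    cell : ℕ → ℕ → Carrier
    cell m b = weight y m * weight z b

    private
      rowTerm : ℕ → (ℕ → Bool) → ℕ → ℕ → Carrier
      rowTerm m S n b = if S b then cell m b * rowSeries m (repeats m b) n else 0#

    -- Either the first letter is matched below m, or it is a letter b in S matched with m. In the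
    -- latter case the cell (m, b) is split off, and `repeats m b` governs what follows.
    rowSeries-suc : ∀ m S n → rowSeries m S (suc n) ≈ wordSeries m (suc n) + sumBelow M (rowTerm m S n)
    rowSeries-suc m S n = begin
      rowSeries m S (suc n)
        ≈⟨ Σ-cong (words M (suc n)) split ⟩
      Σ (words M (suc n)) (λ w → wordWeight w * N y (spat w) m + extra w)
        ≈⟨ Σ-+ (words M (suc n)) _ _ ⟩
      wordSeries m (suc n) + Σ (words M (suc n)) extra
        ≈⟨ +-congˡ (trans (Σ-words M n extra) (trans (Σ-cong (upTo M) inner) (Σ-upTo M _))) ⟩
      wordSeries m (suc n) + sumBelow M (rowTerm m S n) ∎
      where
      extra : List ℕ → Carrier
      extra []      = 0#
      extra (b ∷ w) = wordWeight (b ∷ w) *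
        (if S b then weight y m * N y (spat w) (bound (headDescends b w) m) else 0#)

      split : ∀ w → wordWeight w * restricted m S w ≈ wordWeight w * N y (spat w) m + extra w
      split []      = sym (+-identityʳ _)
      split (b ∷ w) = distribˡ _ _ _

      inner : ∀ b → Σ (words M n) (λ w → extra (b ∷ w)) ≈ rowTerm m S n b
      inner b with S b
      ... | false = Σ-0 (words M n) (λ w → zeroʳ _)
      ... | true  = trans (Σ-cong (words M n) (λ w → trans (*-congˡ (*-congˡ (N-bound m b w))) (rearrange w)))
                          (Σ-*ˡ (words M n) (cell m b) _)
        where
        rearrange : ∀ w → wordWeight (b ∷ w) * (weight y m * restricted m (repeats m b) w) ≈
                          cell m b * (wordWeight w * restricted m (repeats m b) w)
        rearrange w = solve 4 (λ p q r t → p :* q :* (r :* t) := r :* p :* (q :* t)) refl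
                        (weight z b) (wordWeight w) (weight y m) (restricted m (repeats m b) w)
          where open Solver commutativeSemiring using (solve; _:=_; _:*_)

    -- Only first letters are tested against S, and these are below M.
    rowSeries-cong : ∀ m {S S′} → (∀ b → b < M → S b ≡ S′ b) → rowSeries m S ≋ rowSeries m S′
    rowSeries-cong m h zero    = refl
    rowSeries-cong m {S} {S′} h (suc n) = trans (rowSeries-suc m S n) (trans
      (+-congˡ (sumBelow-cong M (λ b b<M → reflexive
        (≡.cong (λ s → if s then cell m b * rowSeries m (repeats m b) n else 0#) (h b b<M)))))
      (sym (rowSeries-suc m S′ n)))

    rowSeries-update : ∀ m {S S′} k → k < M → S k ≡ true → S′ k ≡ false → (∀ b → b ≢ k → S b ≡ S′ b) →
      rowSeries m S ≋ add (rowSeries m S′) (shift (scale (cell m k) (rowSeries m (repeats m k))))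
    rowSeries-update m k k<M on off eq zero    = sym (+-identityʳ _)
    rowSeries-update m {S} {S′} k k<M on off eq (suc n) = begin
      rowSeries m S (suc n)
        ≈⟨ rowSeries-suc m S n ⟩
      wordSeries m (suc n) + sumBelow M (rowTerm m S n)
        ≈⟨ +-congˡ (sumBelow-update M k _ k<M at-k (λ b b≢k → reflexive
             (≡.cong (λ s → if s then cell m b * rowSeries m (repeats m b) n else 0#) (eq b b≢k)))) ⟩
      wordSeries m (suc n) + (sumBelow M (rowTerm m S′ n) + cell m k * rowSeries m (repeats m k) n)
        ≈⟨ +-assoc _ _ _ ⟨
      wordSeries m (suc n) + sumBelow M (rowTerm m S′ n) + cell m k * rowSeries m (repeats m k) n
        ≈⟨ +-congʳ (rowSeries-suc m S′ n) ⟨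
      rowSeries m S′ (suc n) + cell m k * rowSeries m (repeats m k) n ∎
      where
      at-k : rowTerm m S n k ≈ rowTerm m S′ n k + cell m k * rowSeries m (repeats m k) n
      at-k rewrite on | off = sym (+-identityˡ _)

    plainRow-step : ∀ m k → odd m ≡ false → k < M →
      rowSeries m (below (suc k)) ≋
      (if odd k then onePlus₁ (cell m k) else geom₁ (cell m k)) ⊗₁ rowSeries m (below k)
    plainRow-step m k even-m k<M = choose (P.trans
      (rowSeries-update m k k<M (<ᵇ-true {k} ℕ.≤-refl) (<ᵇ-false {k} ℕ.≤-refl) (λ b → <ᵇ-suc))
      (P.+-congˡ {rowSeries m (below k)} λ { zero → refl ; (suc n) → *-congˡ (rowSeries-cong m repeats≡ n) }))
      where
      repeats≡ : ∀ b → b < M → repeats m k b ≡ below (bound false k) b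
      repeats≡ b _ rewrite even-m = not-superDescends k b
      choose : rowSeries m (below (suc k)) ≋
                 add (rowSeries m (below k)) (shift (scale (cell m k) (rowSeries m (below (bound false k))))) →
               rowSeries m (below (suc k)) ≋
                 (if odd k then onePlus₁ (cell m k) else geom₁ (cell m k)) ⊗₁ rowSeries m (below k)
      choose eq with odd k
      ... | true  = P.trans eq (onePlus-⊗₁ _ _)
      ... | false = geom-⊗₁ _ _ _ eq

    barredRow-step : ∀ m k → odd m ≡ true → k < M →
      rowSeries m (above k) ≋
      (if odd k then geom₁ (cell m k) else onePlus₁ (cell m k)) ⊗₁ rowSeries m (above (suc k))
    barredRow-step m k odd-m k<M = choose (P.trans
      (rowSeries-update m k k<M (≡.cong not (<ᵇ-false {k} ℕ.≤-refl)) (≡.cong not (<ᵇ-true {k} ℕ.≤-refl))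
        (λ b b≢k → ≡.cong not (≡.sym (<ᵇ-suc b≢k))))
      (P.+-congˡ {rowSeries m (above (suc k))} λ { zero → refl ; (suc n) → *-congˡ (rowSeries-cong m repeats≡ n) }))
      where
      repeats≡ : ∀ b → b < M → repeats m k b ≡ above (bound false k) b
      repeats≡ b _ rewrite odd-m = ≡.trans (≡.sym (not-involutive _)) (≡.cong not (not-superDescends k b))
      choose : rowSeries m (above k) ≋
                 add (rowSeries m (above (suc k))) (shift (scale (cell m k) (rowSeries m (above (bound false k))))) →
               rowSeries m (above k) ≋
                 (if odd k then geom₁ (cell m k) else onePlus₁ (cell m k)) ⊗₁ rowSeries m (above (suc k))
      choose eq with odd k
      ... | true  = geom-⊗₁ _ _ _ eq
      ... | false = P.trans eq (onePlus-⊗₁ _ _)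

  onePlus₁-cong : ∀ {a b} → a ≈ b → onePlus₁ a ≋ onePlus₁ b
  onePlus₁-cong p zero          = refl
  onePlus₁-cong p (suc zero)    = p
  onePlus₁-cong p (suc (suc k)) = refl

  geom₁-cong : ∀ {a b} → a ≈ b → geom₁ a ≋ geom₁ b
  geom₁-cong p zero    = refl
  geom₁-cong p (suc k) = *-cong p (geom₁-cong p k)

  pow₁-+ : ∀ f a b → pow₁ f (a ℕ.+ b) ≋ pow₁ f a ⊗₁ pow₁ f b
  pow₁-+ f zero    b = P.sym (⊗₁-identityˡ (pow₁ f b))
  pow₁-+ f (suc a) b = P.trans (P.*-congˡ {f} (pow₁-+ f a b)) (P.sym (⊗₁-assoc f (pow₁ f a) (pow₁ f b)))

  open SetoidReasoning P.setoid

  barred plain : PS1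
  barred = onePlus₁ y ⊗₁ geom₁ (y * z)
  plain  = onePlus₁ z ⊗₁ geom₁ 1#

  ⊗₁-reassoc : ∀ a b c d → a ⊗₁ (b ⊗₁ (c ⊗₁ d)) ≋ ((a ⊗₁ b) ⊗₁ c) ⊗₁ d
  ⊗₁-reassoc a b c d = P.trans (P.sym (⊗₁-assoc a b (c ⊗₁ d))) (P.sym (⊗₁-assoc (a ⊗₁ b) c d))

  twice-< : ∀ {k j} → k < j → suc (twice k) < twice j
  twice-< {zero}  (s≤s z≤n)     = s≤s (s≤s z≤n)
  twice-< {suc k} (s≤s k<j)     = s≤s (s≤s (twice-< k<j))

  -- The letters of B come in j pairs of a plain and a barred one; in a plain row such a pair
  -- contributes 1/(1-x) and 1+zx.
  plainRow : ∀ j m → odd m ≡ false →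
    wordSeries (twice j) (suc m) ≋ pow₁ plain j ⊗₁ wordSeries (twice j) m
  plainRow j m even-m = P.trans (P.sym (rowSeries-true M m)) (P.trans
    (rowSeries-cong M m (λ b b<M → ≡.sym (<ᵇ-true b<M)))
    (P.trans (pairs j ℕ.≤-refl) (P.*-congˡ {pow₁ plain j} (rowSeries-false M m))))
    where
    M = twice j
    pairs : ∀ k → k ≤ j → rowSeries M m (below (twice k)) ≋ pow₁ plain k ⊗₁ rowSeries M m (λ _ → false)
    pairs zero    k≤j = P.sym (⊗₁-identityˡ _)
    pairs (suc k) k<j = begin
      rowSeries M m (below (suc (suc (twice k))))
        ≈⟨ plainRow-step M m (suc (twice k)) even-m (twice-< k<j) ⟩
      (if not (odd (twice k)) then onePlus₁ (cell M m (suc (twice k))) else geom₁ (cell M m (suc (twice k)))) ⊗₁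
        rowSeries M m (below (suc (twice k)))
        ≈⟨ P.*-cong first (P.trans (plainRow-step M m (twice k) even-m (ℕ.<-trans ℕ.≤-refl (twice-< k<j)))
             (P.*-cong second (pairs k (ℕ.<⇒≤ k<j)))) ⟩
      onePlus₁ z ⊗₁ (geom₁ 1# ⊗₁ (pow₁ plain k ⊗₁ rowSeries M m (λ _ → false)))
        ≈⟨ ⊗₁-reassoc _ _ _ (rowSeries M m (λ _ → false)) ⟩
      pow₁ plain (suc k) ⊗₁ rowSeries M m (λ _ → false) ∎
      where
      first : (if not (odd (twice k)) then onePlus₁ (cell M m (suc (twice k))) else geom₁ (cell M m (suc (twice k)))) ≋ onePlus₁ z
      first rewrite odd-twice k | even-m = onePlus₁-cong (*-identityˡ z)
      second : (if odd (twice k) then onePlus₁ (cell M m (twice k)) else geom₁ (cell M m (twice k))) ≋ geom₁ 1#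
      second rewrite odd-twice k | even-m = geom₁-cong (*-identityˡ 1#)

  barredRow : ∀ j m → odd m ≡ true →
    wordSeries (twice j) (suc m) ≋ pow₁ barred j ⊗₁ wordSeries (twice j) m
  barredRow j m odd-m = P.trans (P.sym (rowSeries-true M m)) (P.trans
    (pairs j 0 (ℕ.+-identityʳ j)) (P.*-congˡ {pow₁ barred j} (P.trans
      (rowSeries-cong M m (λ b b<M → ≡.cong not (<ᵇ-true b<M))) (rowSeries-false M m))))
    where
    M = twice j
    -- The induction runs on r, the number of pairs with codes from `twice k` upward, because a
    -- barred row starts from the largest codes.
    pairs : ∀ r k → r ℕ.+ k ≡ j → rowSeries M m (above (twice k)) ≋ pow₁ barred r ⊗₁ rowSeries M m (above M)
    pairs zero    k ≡.refl = P.sym (⊗₁-identityˡ _)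
    pairs (suc r) k r+k≡j = begin
      rowSeries M m (above (twice k))
        ≈⟨ barredRow-step M m (twice k) odd-m (ℕ.<-trans ℕ.≤-refl (twice-< k<j)) ⟩
      (if odd (twice k) then geom₁ (cell M m (twice k)) else onePlus₁ (cell M m (twice k))) ⊗₁
        rowSeries M m (above (suc (twice k)))
        ≈⟨ P.*-cong first (P.trans (barredRow-step M m (suc (twice k)) odd-m (twice-< k<j))
             (P.*-cong second (pairs r (suc k) (≡.trans (ℕ.+-suc r k) r+k≡j)))) ⟩
      onePlus₁ y ⊗₁ (geom₁ (y * z) ⊗₁ (pow₁ barred r ⊗₁ rowSeries M m (above M)))
        ≈⟨ ⊗₁-reassoc _ _ _ (rowSeries M m (above M)) ⟩
      pow₁ barred (suc r) ⊗₁ rowSeries M m (above M) ∎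
      where
      k<j : k < j
      k<j = ≡.subst (k <_) r+k≡j (s≤s (ℕ.m≤n+m k r))
      first : (if odd (twice k) then geom₁ (cell M m (twice k)) else onePlus₁ (cell M m (twice k))) ≋ onePlus₁ y
      first rewrite odd-twice k | odd-m = onePlus₁-cong (*-identityʳ y)
      second : (if not (odd (twice k)) then geom₁ (cell M m (suc (twice k))) else onePlus₁ (cell M m (suc (twice k)))) ≋ geom₁ (y * z)
      second rewrite odd-twice k | odd-m = P.refl

  -- The 2i + 1 letters of A alternate between i + 1 plain and i barred ones, each adding a full row
  -- of j pairs of cells.
  wordSeries-odd : ∀ i j → wordSeries (twice j) (suc (twice i)) ≋ pow₁ barred (i ℕ.* j) ⊗₁ pow₁ plain (suc i ℕ.* j)
  wordSeries-odd zero j = begin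
    wordSeries (twice j) 1               ≈⟨ plainRow j 0 ≡.refl ⟩
    pow₁ plain j ⊗₁ wordSeries (twice j) 0
                                         ≈⟨ P.*-congˡ {pow₁ plain j} (wordSeries-0 (twice j)) ⟩
    pow₁ plain j ⊗₁ pow₁ plain 0         ≈⟨ pow₁-+ plain j 0 ⟨
    pow₁ plain (j ℕ.+ 0)                 ≈⟨ ⊗₁-identityˡ _ ⟨
    δ ⊗₁ pow₁ plain (j ℕ.+ 0)            ∎
  wordSeries-odd (suc i) j = begin
    wordSeries (twice j) (suc (suc (suc (twice i))))
      ≈⟨ plainRow j _ (odd-twice (suc i)) ⟩
    pow₁ plain j ⊗₁ wordSeries (twice j) (suc (suc (twice i)))
      ≈⟨ P.*-congˡ {pow₁ plain j} (barredRow j _ (≡.cong not (odd-twice i))) ⟩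
    pow₁ plain j ⊗₁ (pow₁ barred j ⊗₁ wordSeries (twice j) (suc (twice i)))
      ≈⟨ P.*-congˡ {pow₁ plain j} (P.*-congˡ {pow₁ barred j} (wordSeries-odd i j)) ⟩
    pow₁ plain j ⊗₁ (pow₁ barred j ⊗₁ (pow₁ barred (i ℕ.* j) ⊗₁ pow₁ plain (suc i ℕ.* j)))
      ≈⟨ solve 4 (λ p b b′ p′ → p :* (b :* (b′ :* p′)) := (b :* b′) :* (p :* p′)) P.refl
           (pow₁ plain j) (pow₁ barred j) (pow₁ barred (i ℕ.* j)) (pow₁ plain (suc i ℕ.* j)) ⟩
    (pow₁ barred j ⊗₁ pow₁ barred (i ℕ.* j)) ⊗₁ (pow₁ plain j ⊗₁ pow₁ plain (suc i ℕ.* j))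
      ≈⟨ P.*-cong (P.sym (pow₁-+ barred j (i ℕ.* j))) (P.sym (pow₁-+ plain j (suc i ℕ.* j))) ⟩
    pow₁ barred (suc i ℕ.* j) ⊗₁ pow₁ plain (suc (suc i) ℕ.* j) ∎
    where
    open Solver P.commutativeSemiring using (solve; _:=_; _:*_)

-- From the sum over permutations to the sum over words.

open Permutations

module _ {c ℓ} (R : CommutativeRing c ℓ) (y z : CommutativeRing.Carrier R) where
  open CommutativeRing R hiding (zero)
  open Series R
  open Bivariate R
  open Sums R
  open CellProduct R y z
  open SetoidReasoning setoid
  open CommutativeSemigroupProperties *-commutativeSemigroup using (x∙yz≈y∙xz)

  if-*ˡ : ∀ s x a → (if s then x * a else 0#) ≈ x * (if s then a else 0#)
  if-*ˡ true  x a = refl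
  if-*ˡ false x a = sym (zeroʳ x)

  wordWeight-↭ : ∀ {v w} → v ↭ w → wordWeight v ≈ wordWeight w
  wordWeight-↭ _↭_.refl        = refl
  wordWeight-↭ (prep a p)      = *-congˡ (wordWeight-↭ p)
  wordWeight-↭ (swap a b p)    = trans (x∙yz≈y∙xz _ _ _) (*-congˡ (*-congˡ (wordWeight-↭ p)))
  wordWeight-↭ (_↭_.trans p q) = trans (wordWeight-↭ p) (wordWeight-↭ q)

  N-sumBelow : ∀ d ds b → N z (d ∷ ds) b ≈ sumBelow b (λ c → weight z c * N z ds (bound d c))
  N-sumBelow d ds zero    = refl
  N-sumBelow d ds (suc b) = +-congʳ (N-sumBelow d ds b)

  -- The bound on the next letter varies along the sequence, so words are taken over one fixed
  -- larger alphabet and the bounds are imposed by indicators.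
  N-words : ∀ ds {b M} → b ≤ M → N z ds b ≈
    Σ (words M (length ds)) (λ g → if headBelow b g ∧ compatible ds g then wordWeight g else 0#)
  N-words []       b≤M = sym (+-identityʳ _)
  N-words (d ∷ ds) {b} {M} b≤M = begin
    N z (d ∷ ds) b
      ≈⟨ N-sumBelow d ds b ⟩
    sumBelow b (λ c → weight z c * N z ds (bound d c))
      ≈⟨ sumBelow-extend _ b≤M ⟩
    sumBelow M (λ c → if c <ᵇ b then weight z c * N z ds (bound d c) else 0#)
      ≈⟨ sumBelow-cong M inner ⟩
    sumBelow M (λ c → Σ (words M (length ds)) (λ g → summand (c ∷ g)))
      ≈⟨ Σ-upTo M _ ⟨
    Σ (upTo M) (λ c → Σ (words M (length ds)) (λ g → summand (c ∷ g)))
      ≈⟨ Σ-words M (length ds) summand ⟨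
    Σ (words M (suc (length ds))) summand ∎
    where
    summand : List ℕ → Carrier
    summand g = if headBelow b g ∧ compatible (d ∷ ds) g then wordWeight g else 0#
    inner : ∀ c → c < M → (if c <ᵇ b then weight z c * N z ds (bound d c) else 0#) ≈
            Σ (words M (length ds)) (λ g → summand (c ∷ g))
    inner c c<M with c <ᵇ b
    ... | false = sym (Σ-0 (words M (length ds)) (λ _ → refl))
    -- The next bound is at most c + 1, hence still at most M.
    ... | true  = trans (*-congˡ (N-words ds (ℕ.≤-trans (bound-≤ d c) c<M))) (trans
      (sym (Σ-*ˡ (words M (length ds)) (weight z c) _))
      (Σ-cong (words M (length ds)) (λ g → sym (if-*ˡ _ (weight z c) (wordWeight g)))))

  N-compatible : ∀ {n τ} M → length τ ≡ n →
    N z (pat τ) M ≈ Σ (words M n) (λ g → if compatible (pat τ) g then wordWeight g else 0#)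
  N-compatible {n} {τ} M ≡.refl = trans (N-words (pat τ) ℕ.≤-refl) (trans
    (reflexive (≡.cong (λ m → Σ (words M m) (λ g → if headBelow M g ∧ compatible (pat τ) g then wordWeight g else 0#)) (length-pattern descends τ)))
    (Σ-cong-∈ (words M n) (λ {g} g∈ → reflexive
      (≡.cong (λ s → if s ∧ compatible (pat τ) g then wordWeight g else 0#) (head< (proj₂ (∈-words⁻ n g∈)))))))
    where
    head< : ∀ {g} → All (_< M) g → headBelow M g ≡ true
    head< []          = ≡.refl
    head< (c<M ∷ _)   = <ᵇ-true c<M

  -- Expanding `N` into sequences g gives a sum over compatible pairs, which `compose` carries
  -- bijectively to words. F is preserved because π and its word have the same pattern.
  sum-over-words : ∀ n M (F : List Bool → Carrier) →
    Σ (Sym n) (λ π → F (pat π) * N z (pat (inverse π)) M) ≈ Σ (words M n) (λ w → wordWeight w * F (spat w))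
  sum-over-words n M F = begin
    Σ (Sym n) (λ π → F (pat π) * N z (pat (inverse π)) M)
      ≈⟨ Σ-cong-∈ (Sym n) (λ {π} π∈ → trans
           (*-congˡ (N-compatible {τ = inverse π} M (Permutation.length-inverse {n} π∈)))
           (trans (sym (Σ-*ˡ (words M n) _ _)) (Σ-cong (words M n) (λ g → sym (if-*ˡ _ _ (wordWeight g)))))) ⟩
    Σ (Sym n) (λ π → Σ (words M n) (λ g → if compatiblePair (π , g) then pairTerm (π , g) else 0#))
      ≈⟨ Σ-cartesianProduct (Sym n) (words M n) _ ⟨
    Σ (cartesianProduct (Sym n) (words M n)) (λ x → if compatiblePair x then pairTerm x else 0#)
      ≈⟨ Σ-filterᵇ compatiblePair (cartesianProduct (Sym n) (words M n)) pairTerm ⟨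
    Σ pairs pairTerm
      ≈⟨ Σ-cong-∈ pairs standardized ⟩
    Σ pairs (λ x → wordWeight (compose x) * F (spat (compose x)))
      ≈⟨ Σ-map compose pairs _ ⟨
    Σ (map compose pairs) (λ w → wordWeight w * F (spat w))
      ≈⟨ Σ-↭ _ compose-pairs ⟩
    Σ (words M n) (λ w → wordWeight w * F (spat w)) ∎
    where
    open Standardization M n
    pairTerm : List ℕ × List ℕ → Carrier
    pairTerm (π , g) = F (pat π) * wordWeight g
    standardized : ∀ {x} → x ∈ pairs → pairTerm x ≈ wordWeight (compose x) * F (spat (compose x))
    standardized x∈ with π∈ , g∈ , t ← ∈-pairs⁻ x∈ = trans (*-comm _ _) (*-cong
      (sym (wordWeight-↭ (Compatible.compose-↭ π∈ g∈)))
      (reflexive (≡.cong F (Compatible.pattern-w π∈ g∈ t))))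

  sumList-⊗ : ∀ {A : Set} (as : List A) f h i j → (sumList as f ⊗ h) i j ≈ Σ as (λ a → (f a ⊗ h) i j)
  sumList-⊗ []       f h i j = trans (⊗≈* zero₂ h i j) (Q.zeroˡ h i j)
  sumList-⊗ (a ∷ as) f h i j = begin
    ((f a ⊕ sumList as f) ⊗ h) i j               ≈⟨ ⊗≈* (f a ⊕ sumList as f) h i j ⟩
    ((f a ⊕ sumList as f) Q.* h) i j             ≈⟨ Q.distribʳ h (f a) (sumList as f) i j ⟩
    (f a Q.* h) i j + (sumList as f Q.* h) i j   ≈⟨ +-cong (⊗≈* (f a) h i j) (⊗≈* (sumList as f) h i j) ⟨
    (f a ⊗ h) i j + (sumList as f ⊗ h) i j       ≈⟨ +-congˡ (sumList-⊗ as f h i j) ⟩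
    (f a ⊗ h) i j + Σ as (λ a → (f a ⊗ h) i j)   ∎

  term-value : ∀ n {π} i j → π ∈ Sym (suc n) →
    (term y z (suc n) π ⊗ (pow₂ geomS (suc (suc n)) ⊗ pow₂ geomT (suc (suc n)))) i j ≈
    odds y (pat π) i * evens z (pat (inverse π)) j
  term-value n {π} i j π∈ = go π (proj₁ (∈-Sym⁻ {suc n} π∈)) π-unique inverse-unique
    where
    open Permutation {suc n} π∈
    -- The permutation is detached from its membership proof, so that matching on the length
    -- equation can expose its first letter.
    go : ∀ π → length π ≡ suc n → Unique π →
         Unique (inverse π) →
         (term y z (suc n) π ⊗ (pow₂ geomS (suc (suc n)) ⊗ pow₂ geomT (suc (suc n)))) i j ≈
         odds y (pat π) i * evens z (pat (inverse π)) j
    go (a ∷ π) ≡.refl uniq uniq⁻¹ = term-product y z a π uniq uniq⁻¹ i j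

  -- For positive n each permutation contributes its two compatible weights, and `sum-over-words` is
  -- applied with F the weight over A. For n = 0 only the empty word remains.
  LHS≈wordSeries : ∀ n i j → LHS y z n i j ≈ wordSeries (twice j) (suc (twice i)) n
  LHS≈wordSeries zero i j = begin
    (geomS ⊗ geomT) i j                    ≈⟨ ⊗-cong {geomS} {inS (λ _ → 1#)} {geomT} {inT (λ _ → 1#)}
                                                (λ i j → sym (*-identityʳ _)) (λ i j → sym (*-identityʳ _)) i j ⟩
    (inS (λ _ → 1#) Q.* inT (λ _ → 1#)) i j ≈⟨ inS-* _ _ i j ⟩
    1# * 1#                                ≈⟨ +-identityʳ _ ⟨
    1# * 1# + 0#                           ∎
  LHS≈wordSeries (suc n) i j = begin
    (numer y z (suc n) ⊗ (pow₂ geomS (suc (suc n)) ⊗ pow₂ geomT (suc (suc n)))) i j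
      ≈⟨ sumList-⊗ (Sym (suc n)) (term y z (suc n)) (pow₂ geomS (suc (suc n)) ⊗ pow₂ geomT (suc (suc n))) i j ⟩
    Σ (Sym (suc n)) (λ π → (term y z (suc n) π ⊗ (pow₂ geomS (suc (suc n)) ⊗ pow₂ geomT (suc (suc n)))) i j)
      ≈⟨ Σ-cong-∈ (Sym (suc n)) (term-value n i j) ⟩
    Σ (Sym (suc n)) (λ π → N y (pat π) (suc (twice i)) * N z (pat (inverse π)) (twice j))
      ≈⟨ sum-over-words (suc n) (twice j) (λ ds → N y ds (suc (twice i))) ⟩
    wordSeries (twice j) (suc (twice i)) (suc n) ∎

theorem4p2 : ∀ {c ℓ} (R : CommutativeRing c ℓ) (y z : CommutativeRing.Carrier R) (n i j : ℕ) →
    CommutativeRing._≈_ R (Series.LHS R y z n i j) (Series.RHS R y z n i j)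
theorem4p2 R y z n i j = CommutativeRing.trans R (LHS≈wordSeries R y z n i j) (CellProduct.wordSeries-odd R y z i j n)
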